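{- Let $d\ge2$, let $f$ be a polynomial in $X_1,\dots,X_{d-1}$ with integer coefficients and constant term $0$ (with a fixed order of multiplication of variables in each monomial), and let $c\in\mathbb{Z}$. Let $R$ be a finite ring with Jacobson radical $J$, and let $S=R/J$ be the semisimple part of $R$. If $C_R$ and $C_S=C_{R/J}$ are the $V_{f,c}$-Salem numbers of $R$ and $S$, then $$C_R\ge C_S\,|J|^{\frac{d-1}{2}}.$$
   Context: Rings are unital with $1\neq 0$ and not necessarily commutative; a polynomial with integer coefficients is a $\mathbb{Z}$-linear combination of words in the variables, so that it defines a function $R^{d-1}\to R$. For a finite ring $R$, $V_{f,c}(R)=\{(x_1,\dots,x_d)\in R^d : x_d=f(x_1,\dots,x_{d-1})+c\}$. For a set $T\subseteq R^d$ and a character $\psi$ of the additive group of $R^d$, put $\widehat{T}(\psi)=\frac{1}{|R|^d}\sum_{x\in T}\psi(x)$. The set $T$ is called $C$-Salem if $|\widehat{T}(\psi)|\le C\,|R|^{ -d}\,|T|^{1/2}$ for all nontrivial additive characters $\psi$ of $R^d$. The $V_{f,c}$-Salem number of $R$ is the smallest $C$ such that $V_{f,c}(R)$ is $C$-Salem. -}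

module Defs where

open import Algebra.Bundles using (Ring; AbelianGroup; RawMonoid)
import Algebra.Construct.Pointwise as Pointwise
import Algebra.Definitions.RawMonoid as RawMonoidDefinitions
open import Algebra.Morphism.Structures using (module MonoidMorphisms)
import Algebra.Properties.Ring as RingProperties
open import Data.Bool.Base using (Bool; T; if_then_else_)
open import Data.Bool.Properties using (T?)
open import Data.Empty using (⊥; ⊥-elim)
open import Data.Fin.Base as Fin using (Fin)
open import Data.Integer.Base as ℤ using (ℤ; +_; -[1+_]; 0ℤ; 1ℤ)
import Data.Fin.Properties as Fin
import Data.Integer.Properties as ℤ
open import Data.Integer.Tactic.RingSolver using () renaming (solve-∀ to ℤ-solve-∀)
open import Data.List.Base as List using (List; []; _∷_)
import Data.List.Membership.Setoid as Membership
open import Data.List.Membership.Setoid.Properties using (∈-filter⁺)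
open import Data.List.Properties using (filter-notAll)
open import Data.List.Relation.Unary.Any as Any using (index)
open import Data.List.Relation.Unary.Enumerates.Setoid using (IsEnumeration)
open import Data.List.Relation.Unary.Enumerates.Setoid.Properties using (deduplicate⁺)
open import Data.List.Relation.Unary.Unique.DecSetoid.Properties using (deduplicate-!)
open import Data.List.Relation.Unary.Unique.Setoid using (Unique)
open import Data.Nat.Base as ℕ using (ℕ; zero; suc)
import Data.Nat.Properties as ℕ
open import Data.Product.Base using (Σ; ∃; _×_; _,_; proj₁; proj₂)
open import Data.Rational.Base as ℚ using (ℚ; mkℚ; 0ℚ; 1ℚ; ½; ↥_; ↧_; ↧ₙ_; *≤*; *<*)
import Data.Rational.Properties as ℚ
import Data.Rational.Unnormalised.Base as ℚᵘ
import Data.Rational.Unnormalised.Properties as ℚᵘ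
open import Data.Sum.Base as Sum using (_⊎_; inj₁; inj₂)
open import Data.Vec.Functional as Vector using (Vector)
open import Level using (Level; _⊔_; 0ℓ)
open import Relation.Binary.Bundles using (Setoid; DecSetoid)
import Relation.Binary.Definitions as Binary
open import Relation.Binary.Definitions using (_Respects_)
open import Relation.Binary.PropositionalEquality as ≡ using (_≡_)
import Relation.Binary.Reasoning.Setoid as ≈-Reasoning
open import Relation.Nullary.Decidable using (_×-dec_; ¬?; dec⇒maybe; decidable-stable; fromWitness; isYes; map′; toWitness)
open import Relation.Nullary using (¬_; Dec; yes; no; does)
open import Relation.Unary using (Pred; Decidable)
open import Tactic.RingSolver using (solve-∀)
open import Tactic.RingSolver.Core.AlmostCommutativeRing using (AlmostCommutativeRing; fromCommutativeRing)

private
  variable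
    a c ℓ p : Level

IsCauchy : (ℕ → ℚ) → Set
IsCauchy s = ∀ ε → 0ℚ ℚ.< ε →
  ∃ λ N → ∀ m n → N ℕ.≤ m → N ℕ.≤ n → ℚ.∣ s m ℚ.- s n ∣ ℚ.≤ ε

record ℝ : Set where
  constructor mkℝ
  field
    seq    : ℕ → ℚ
    cauchy : IsCauchy seq

open ℝ public

infix 4 _≈ℝ_ _≤ℝ_ _≥ℝ_

_≈ℝ_ : ℝ → ℝ → Set
x ≈ℝ y = ∀ ε → 0ℚ ℚ.< ε →
  ∃ λ N → ∀ n → N ℕ.≤ n → ℚ.∣ seq x n ℚ.- seq y n ∣ ℚ.≤ ε

_≤ℝ_ : ℝ → ℝ → Set
x ≤ℝ y = ∀ ε → 0ℚ ℚ.< ε →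
  ∃ λ N → ∀ n → N ℕ.≤ n → seq x n ℚ.≤ seq y n ℚ.+ ε

_≥ℝ_ : ℝ → ℝ → Set
x ≥ℝ y = y ≤ℝ x

private
  ℚ-ring : AlmostCommutativeRing 0ℓ 0ℓ
  ℚ-ring = fromCommutativeRing ℚ.+-*-commutativeRing (λ q → dec⇒maybe (0ℚ ℚ.≟ q))

  x-y≡-[y-x] : ∀ x y → x ℚ.- y ≡ ℚ.- (y ℚ.- x)
  x-y≡-[y-x] = solve-∀ ℚ-ring

  y+e-y≡e : ∀ y e → (y ℚ.+ e) ℚ.- y ≡ e
  y+e-y≡e = solve-∀ ℚ-ring

  +-exchange : ∀ a b c d → (a ℚ.+ b) ℚ.- (c ℚ.+ d) ≡ (a ℚ.- c) ℚ.+ (b ℚ.- d)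
  +-exchange = solve-∀ ℚ-ring

  *-exchange : ∀ a b c d → a ℚ.* b ℚ.- c ℚ.* d ≡ (a ℚ.- c) ℚ.* b ℚ.+ c ℚ.* (b ℚ.- d)
  *-exchange = solve-∀ ℚ-ring

  neg-exchange : ∀ a b → ℚ.- a ℚ.- (ℚ.- b) ≡ b ℚ.- a
  neg-exchange = solve-∀ ℚ-ring

  factor : ∀ A B δ → δ ℚ.* B ℚ.+ A ℚ.* δ ≡ δ ℚ.* (A ℚ.+ B)
  factor = solve-∀ ℚ-ring

  x≡y+[x-y] : ∀ x y → x ≡ y ℚ.+ (x ℚ.- y)
  x≡y+[x-y] = solve-∀ ℚ-ring

  ½-pos : ∀ {ε} → 0ℚ ℚ.< ε → 0ℚ ℚ.< ½ ℚ.* ε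
  ½-pos {ε} 0<ε = ℚ.positive⁻¹ (½ ℚ.* ε) {{ℚ.pos*pos⇒pos ½ ε {{ℚ.positive 0<ε}}}}

  ½+½ : ∀ ε → ½ ℚ.* ε ℚ.+ ½ ℚ.* ε ≡ ε
  ½+½ ε = begin
    ½ ℚ.* ε ℚ.+ ½ ℚ.* ε ≡⟨ ℚ.*-distribʳ-+ ε ½ ½ ⟨
    1ℚ ℚ.* ε            ≡⟨ ℚ.*-identityˡ ε ⟩
    ε                   ∎
    where open ≡.≡-Reasoning

  ∣-∣-swap : ∀ x y → ℚ.∣ x ℚ.- y ∣ ≡ ℚ.∣ y ℚ.- x ∣
  ∣-∣-swap x y = begin
    ℚ.∣ x ℚ.- y ∣         ≡⟨ ≡.cong ℚ.∣_∣ (x-y≡-[y-x] x y) ⟩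
    ℚ.∣ ℚ.- (y ℚ.- x) ∣   ≡⟨ ℚ.∣-p∣≡∣p∣ (y ℚ.- x) ⟩
    ℚ.∣ y ℚ.- x ∣         ∎
    where open ≡.≡-Reasoning

  p≤∣p∣ : ∀ p → p ℚ.≤ ℚ.∣ p ∣
  p≤∣p∣ p with ℚ.∣p∣≡p∨∣p∣≡-p p
  ... | inj₁ eq = ℚ.≤-reflexive (≡.sym eq)
  ... | inj₂ eq with ℚ.≤-total 0ℚ p
  ...   | inj₁ 0≤p = ℚ.≤-reflexive (≡.sym (ℚ.0≤p⇒∣p∣≡p 0≤p))
  ...   | inj₂ p≤0 = ℚ.≤-trans p≤0 (ℚ.0≤∣p∣ p)

  close : ∀ x y {ε} → ℚ.∣ x ℚ.- y ∣ ℚ.≤ ε → x ℚ.≤ y ℚ.+ ε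
  close x y {ε} h = begin
    x                          ≡⟨ x≡y+[x-y] x y ⟩
    y ℚ.+ (x ℚ.- y)            ≤⟨ ℚ.+-monoʳ-≤ y (p≤∣p∣ (x ℚ.- y)) ⟩
    y ℚ.+ ℚ.∣ x ℚ.- y ∣        ≤⟨ ℚ.+-monoʳ-≤ y h ⟩
    y ℚ.+ ε                    ∎
    where open ℚ.≤-Reasoning

  close⁻¹ : ∀ x y {ε} → x ℚ.≤ y ℚ.+ ε → y ℚ.≤ x ℚ.+ ε → ℚ.∣ x ℚ.- y ∣ ℚ.≤ ε
  close⁻¹ x y {ε} h k with ℚ.∣p∣≡p∨∣p∣≡-p (x ℚ.- y)
  ... | inj₁ eq = begin
    ℚ.∣ x ℚ.- y ∣              ≡⟨ eq ⟩
    x ℚ.- y                    ≤⟨ ℚ.+-monoˡ-≤ (ℚ.- y) h ⟩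
    (y ℚ.+ ε) ℚ.- y            ≡⟨ y+e-y≡e y ε ⟩
    ε                          ∎
    where open ℚ.≤-Reasoning
  ... | inj₂ eq = begin
    ℚ.∣ x ℚ.- y ∣              ≡⟨ eq ⟩
    ℚ.- (x ℚ.- y)              ≡⟨ ≡.sym (x-y≡-[y-x] y x) ⟩
    y ℚ.- x                    ≤⟨ ℚ.+-monoˡ-≤ (ℚ.- x) k ⟩
    (x ℚ.+ ε) ℚ.- x            ≡⟨ y+e-y≡e x ε ⟩
    ε                          ∎
    where open ℚ.≤-Reasoning

  *-mono-nonNeg : ∀ {p q r s} → 0ℚ ℚ.≤ p → 0ℚ ℚ.≤ s → p ℚ.≤ q → r ℚ.≤ s → p ℚ.* r ℚ.≤ q ℚ.* s
  *-mono-nonNeg {p} {q} {r} {s} 0≤p 0≤s p≤q r≤s = ℚ.≤-trans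
    (ℚ.*-monoˡ-≤-nonNeg p {{ℚ.nonNegative 0≤p}} r≤s)
    (ℚ.*-monoʳ-≤-nonNeg s {{ℚ.nonNegative 0≤s}} p≤q)

fromℚ : ℚ → ℝ
fromℚ q = mkℝ (λ _ → q) λ ε 0<ε → 0 , λ _ _ _ _ →
  ℚ.≤-trans (ℚ.≤-reflexive (≡.cong ℚ.∣_∣ (ℚ.+-inverseʳ q))) (ℚ.<⇒≤ 0<ε)

fromℕ : ℕ → ℝ
fromℕ n = fromℚ (+ n ℚ./ 1)

infixl 6 _+ℝ_ _-ℝ_
infixl 7 _*ℝ_
infix  8 -ℝ_

private
  +-dist : ∀ a b c d {δ} → ℚ.∣ a ℚ.- c ∣ ℚ.≤ δ → ℚ.∣ b ℚ.- d ∣ ℚ.≤ δ →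
           ℚ.∣ (a ℚ.+ b) ℚ.- (c ℚ.+ d) ∣ ℚ.≤ δ ℚ.+ δ
  +-dist a b c d {δ} h k = begin
    ℚ.∣ (a ℚ.+ b) ℚ.- (c ℚ.+ d) ∣
      ≡⟨ ≡.cong ℚ.∣_∣ (+-exchange a b c d) ⟩
    ℚ.∣ (a ℚ.- c) ℚ.+ (b ℚ.- d) ∣
      ≤⟨ ℚ.∣p+q∣≤∣p∣+∣q∣ (a ℚ.- c) (b ℚ.- d) ⟩
    ℚ.∣ a ℚ.- c ∣ ℚ.+ ℚ.∣ b ℚ.- d ∣
      ≤⟨ ℚ.+-mono-≤ h k ⟩
    δ ℚ.+ δ ∎
    where
    open ℚ.≤-Reasoning

_+ℝ_ : ℝ → ℝ → ℝ
x +ℝ y = mkℝ (λ n → seq x n ℚ.+ seq y n) cauchy-+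
  where
  cauchy-+ : IsCauchy (λ n → seq x n ℚ.+ seq y n)
  cauchy-+ ε 0<ε
    with K , hx ← cauchy x (½ ℚ.* ε) (½-pos 0<ε)
       | L , hy ← cauchy y (½ ℚ.* ε) (½-pos 0<ε)
    = K ℕ.⊔ L , λ m n N≤m N≤n →
      ℚ.≤-trans
        (+-dist (seq x m) (seq y m) (seq x n) (seq y n)
          (hx m n (ℕ.m⊔n≤o⇒m≤o K L N≤m) (ℕ.m⊔n≤o⇒m≤o K L N≤n))
          (hy m n (ℕ.m⊔n≤o⇒n≤o K L N≤m) (ℕ.m⊔n≤o⇒n≤o K L N≤n)))
        (ℚ.≤-reflexive (½+½ ε))

private
  neg-dist : ∀ a b → ℚ.∣ ℚ.- a ℚ.- (ℚ.- b) ∣ ≡ ℚ.∣ a ℚ.- b ∣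
  neg-dist a b = ≡.trans
    (≡.cong ℚ.∣_∣ (neg-exchange a b))
    (∣-∣-swap b a)

-ℝ_ : ℝ → ℝ
-ℝ x = mkℝ (λ n → ℚ.- seq x n) cauchy-neg
  where
  cauchy-neg : IsCauchy (λ n → ℚ.- seq x n)
  cauchy-neg ε 0<ε with N , h ← cauchy x ε 0<ε = N , λ m n N≤m N≤n →
    ℚ.≤-trans (ℚ.≤-reflexive (neg-dist (seq x m) (seq x n))) (h m n N≤m N≤n)

_-ℝ_ : ℝ → ℝ → ℝ
x -ℝ y = x +ℝ (-ℝ y)

private
  bound : ∀ a b → ℚ.∣ a ℚ.- b ∣ ℚ.≤ 1ℚ → ℚ.∣ a ∣ ℚ.≤ ℚ.∣ b ∣ ℚ.+ 1ℚ
  bound a b h = begin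
    ℚ.∣ a ∣                     ≡⟨ ≡.cong ℚ.∣_∣ (x≡y+[x-y] a b) ⟩
    ℚ.∣ b ℚ.+ (a ℚ.- b) ∣       ≤⟨ ℚ.∣p+q∣≤∣p∣+∣q∣ b (a ℚ.- b) ⟩
    ℚ.∣ b ∣ ℚ.+ ℚ.∣ a ℚ.- b ∣   ≤⟨ ℚ.+-monoʳ-≤ ℚ.∣ b ∣ h ⟩
    ℚ.∣ b ∣ ℚ.+ 1ℚ              ∎
    where open ℚ.≤-Reasoning

  bounded : ∀ x → ∃ λ B → (0ℚ ℚ.< B) × ∃ λ N → ∀ n → N ℕ.≤ n → ℚ.∣ seq x n ∣ ℚ.≤ B
  bounded x with N , h ← cauchy x 1ℚ (ℚ.positive⁻¹ 1ℚ) =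
    ℚ.∣ seq x N ∣ ℚ.+ 1ℚ ,
    ℚ.+-mono-≤-< (ℚ.0≤∣p∣ (seq x N)) (ℚ.positive⁻¹ 1ℚ) ,
    N , λ n N≤n → bound (seq x n) (seq x N) (h n N N≤n ℕ.≤-refl)

  *-dist : ∀ a b c d {A B δ} → 0ℚ ℚ.≤ B → 0ℚ ℚ.≤ δ →
           ℚ.∣ c ∣ ℚ.≤ A → ℚ.∣ b ∣ ℚ.≤ B → ℚ.∣ a ℚ.- c ∣ ℚ.≤ δ → ℚ.∣ b ℚ.- d ∣ ℚ.≤ δ →
           ℚ.∣ a ℚ.* b ℚ.- c ℚ.* d ∣ ℚ.≤ δ ℚ.* B ℚ.+ A ℚ.* δ
  *-dist a b c d {A} {B} {δ} 0≤B 0≤δ c≤A b≤B h k = begin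
    ℚ.∣ a ℚ.* b ℚ.- c ℚ.* d ∣
      ≡⟨ ≡.cong ℚ.∣_∣ (*-exchange a b c d) ⟩
    ℚ.∣ (a ℚ.- c) ℚ.* b ℚ.+ c ℚ.* (b ℚ.- d) ∣
      ≤⟨ ℚ.∣p+q∣≤∣p∣+∣q∣ ((a ℚ.- c) ℚ.* b) (c ℚ.* (b ℚ.- d)) ⟩
    ℚ.∣ (a ℚ.- c) ℚ.* b ∣ ℚ.+ ℚ.∣ c ℚ.* (b ℚ.- d) ∣
      ≡⟨ ≡.cong₂ ℚ._+_ (ℚ.∣p*q∣≡∣p∣*∣q∣ (a ℚ.- c) b) (ℚ.∣p*q∣≡∣p∣*∣q∣ c (b ℚ.- d)) ⟩
    ℚ.∣ a ℚ.- c ∣ ℚ.* ℚ.∣ b ∣ ℚ.+ ℚ.∣ c ∣ ℚ.* ℚ.∣ b ℚ.- d ∣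
      ≤⟨ ℚ.+-mono-≤ (*-mono-nonNeg (ℚ.0≤∣p∣ (a ℚ.- c)) 0≤B h b≤B)
                    (*-mono-nonNeg (ℚ.0≤∣p∣ c) 0≤δ c≤A k) ⟩
    δ ℚ.* B ℚ.+ A ℚ.* δ ∎
    where
    open ℚ.≤-Reasoning

  -- For positive B there is δ > 0 with δ * B = ε.
  divide : ∀ {ε} B → 0ℚ ℚ.< ε → 0ℚ ℚ.< B → ∃ λ δ → (0ℚ ℚ.< δ) × (δ ℚ.* B ≡ ε)
  divide {ε} B 0<ε 0<B = ε ℚ.* 1/B , 0<δ , (begin
    (ε ℚ.* 1/B) ℚ.* B ≡⟨ ℚ.*-assoc ε 1/B B ⟩
    ε ℚ.* (1/B ℚ.* B) ≡⟨ ≡.cong (ε ℚ.*_) (ℚ.*-inverseˡ B) ⟩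
    ε ℚ.* 1ℚ          ≡⟨ ℚ.*-identityʳ ε ⟩
    ε                 ∎)
    where
    open ≡.≡-Reasoning
    instance
      B>0 : ℚ.Positive B
      B>0 = ℚ.positive 0<B
      B≢0 : ℚ.NonZero B
      B≢0 = ℚ.pos⇒nonZero B
    1/B = ℚ.1/ B
    0<δ : 0ℚ ℚ.< ε ℚ.* 1/B
    0<δ = ℚ.positive⁻¹ (ε ℚ.* 1/B)
      {{ℚ.pos*pos⇒pos ε {{ℚ.positive 0<ε}} 1/B {{ℚ.1/pos⇒pos B}}}}

  *-close : ∀ a b c d {A B δ ε} → 0ℚ ℚ.< B → 0ℚ ℚ.< δ → δ ℚ.* (A ℚ.+ B) ≡ ε →
            ℚ.∣ c ∣ ℚ.≤ A → ℚ.∣ b ∣ ℚ.≤ B → ℚ.∣ a ℚ.- c ∣ ℚ.≤ δ → ℚ.∣ b ℚ.- d ∣ ℚ.≤ δ →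
            ℚ.∣ a ℚ.* b ℚ.- c ℚ.* d ∣ ℚ.≤ ε
  *-close a b c d {A} {B} {δ} {ε} 0<B 0<δ eq c≤A b≤B h k = begin
    ℚ.∣ a ℚ.* b ℚ.- c ℚ.* d ∣ ≤⟨ *-dist a b c d (ℚ.<⇒≤ 0<B) (ℚ.<⇒≤ 0<δ) c≤A b≤B h k ⟩
    δ ℚ.* B ℚ.+ A ℚ.* δ       ≡⟨ factor A B δ ⟩
    δ ℚ.* (A ℚ.+ B)           ≡⟨ eq ⟩
    ε                         ∎
    where open ℚ.≤-Reasoning

  *-cauchy : ∀ {A B δ ε} (s t : ℕ → ℚ) (K L K′ L′ : ℕ) →
             0ℚ ℚ.< B → 0ℚ ℚ.< δ → δ ℚ.* (A ℚ.+ B) ≡ ε →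
             (∀ n → K ℕ.≤ n → ℚ.∣ s n ∣ ℚ.≤ A) →
             (∀ n → L ℕ.≤ n → ℚ.∣ t n ∣ ℚ.≤ B) →
             (∀ m n → K′ ℕ.≤ m → K′ ℕ.≤ n → ℚ.∣ s m ℚ.- s n ∣ ℚ.≤ δ) →
             (∀ m n → L′ ℕ.≤ m → L′ ℕ.≤ n → ℚ.∣ t m ℚ.- t n ∣ ℚ.≤ δ) →
             ∃ λ N → ∀ m n → N ℕ.≤ m → N ℕ.≤ n → ℚ.∣ s m ℚ.* t m ℚ.- s n ℚ.* t n ∣ ℚ.≤ ε
  *-cauchy s t K L K′ L′ 0<B 0<δ eq hs ht hs′ ht′ = (K ℕ.⊔ L) ℕ.⊔ (K′ ℕ.⊔ L′) , λ m n N≤m N≤n →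
    let N₁≤m = ℕ.m⊔n≤o⇒m≤o (K ℕ.⊔ L) (K′ ℕ.⊔ L′) N≤m
        N₁≤n = ℕ.m⊔n≤o⇒m≤o (K ℕ.⊔ L) (K′ ℕ.⊔ L′) N≤n
        N₂≤m = ℕ.m⊔n≤o⇒n≤o (K ℕ.⊔ L) (K′ ℕ.⊔ L′) N≤m
        N₂≤n = ℕ.m⊔n≤o⇒n≤o (K ℕ.⊔ L) (K′ ℕ.⊔ L′) N≤n
    in *-close (s m) (t m) (s n) (t n) 0<B 0<δ eq
         (hs n (ℕ.m⊔n≤o⇒m≤o K L N₁≤n))
         (ht m (ℕ.m⊔n≤o⇒n≤o K L N₁≤m))
         (hs′ m n (ℕ.m⊔n≤o⇒m≤o K′ L′ N₂≤m) (ℕ.m⊔n≤o⇒m≤o K′ L′ N₂≤n))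
         (ht′ m n (ℕ.m⊔n≤o⇒n≤o K′ L′ N₂≤m) (ℕ.m⊔n≤o⇒n≤o K′ L′ N₂≤n))

_*ℝ_ : ℝ → ℝ → ℝ
x *ℝ y = mkℝ (λ n → seq x n ℚ.* seq y n) cauchy-*
  where
  cauchy-* : IsCauchy (λ n → seq x n ℚ.* seq y n)
  cauchy-* ε 0<ε =
    let A , 0<A , K , hA = bounded x
        B , 0<B , L , hB = bounded y
        δ , 0<δ , eq = divide (A ℚ.+ B) 0<ε (ℚ.+-mono-< 0<A 0<B)
        K′ , hx = cauchy x δ 0<δ
        L′ , hy = cauchy y δ 0<δ
    in *-cauchy {A} {B} {δ} {ε} (seq x) (seq y) K L K′ L′ 0<B 0<δ eq hA hB hx hy

private
  greatest : {P : Pred ℕ p} → Decidable P → ℕ → ℕ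
  greatest P? zero    = zero
  greatest P? (suc k) = if does (P? (suc k)) then suc k else greatest P? k

-- The largest multiple k / (n + 1) whose square is at most q, or 0 if q is
-- negative.  For k = K + 1, where K = (n + 1) (|numerator of q| + 1), the square
-- exceeds q, so searching up to K is enough.

√-Below : ℕ → ℚ → ℕ → Set
√-Below n q k = (+ k ℚ./ suc n) ℚ.* (+ k ℚ./ suc n) ℚ.≤ q

√-below? : ∀ n q → Decidable (√-Below n q)
√-below? n q k = (+ k ℚ./ suc n) ℚ.* (+ k ℚ./ suc n) ℚ.≤? q

√-numerator : ℕ → ℚ → ℕ
√-numerator n q = greatest (√-below? n q) (suc n ℕ.* suc ℤ.∣ ↥ q ∣)

√-approx : ℕ → ℚ → ℚ
√-approx n q = + √-numerator n q ℚ./ suc n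

private
  greatest-holds : {P : Pred ℕ p} (P? : Decidable P) (k : ℕ) →
                   greatest P? k ≡ 0 ⊎ P (greatest P? k)
  greatest-holds P? zero    = inj₁ ≡.refl
  greatest-holds P? (suc k) with P? (suc k)
  ... | yes Pk = inj₂ Pk
  ... | no  _  = greatest-holds P? k

  greatest-maximal : {P : Pred ℕ p} (P? : Decidable P) (k : ℕ) →
                     ¬ P (suc k) → ¬ P (suc (greatest P? k))
  greatest-maximal P? zero    ¬P = ¬P
  greatest-maximal P? (suc k) ¬P with P? (suc k)
  ... | yes _  = ¬P
  ... | no ¬Pk = greatest-maximal P? k ¬Pk

  toℚᵘ-/ : ∀ i n → ℚ.toℚᵘ (i ℚ./ suc n) ℚᵘ.≃ ℚᵘ.mkℚᵘ i n
  toℚᵘ-/ i n = ℚ.toℚᵘ-fromℚᵘ (ℚᵘ.mkℚᵘ i n)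

  suc-/ : ∀ k n → + suc k ℚ./ suc n ≡ (+ k ℚ./ suc n) ℚ.+ (1ℤ ℚ./ suc n)
  suc-/ k n = ℚ.toℚᵘ-injective (begin-equality
    ℚ.toℚᵘ (+ suc k ℚ./ suc n)                        ≃⟨ toℚᵘ-/ (+ suc k) n ⟩
    ℚᵘ.mkℚᵘ (+ suc k) n                               ≃⟨ ℚᵘ.*≡* eq ⟩
    ℚᵘ.mkℚᵘ (+ k) n ℚᵘ.+ ℚᵘ.mkℚᵘ 1ℤ n                 ≃⟨ ℚᵘ.+-cong (toℚᵘ-/ (+ k) n) (toℚᵘ-/ 1ℤ n) ⟨
    ℚ.toℚᵘ (+ k ℚ./ suc n) ℚᵘ.+ ℚ.toℚᵘ (1ℤ ℚ./ suc n) ≃⟨ ℚ.toℚᵘ-homo-+ (+ k ℚ./ suc n) (1ℤ ℚ./ suc n) ⟨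
    ℚ.toℚᵘ ((+ k ℚ./ suc n) ℚ.+ (1ℤ ℚ./ suc n))       ∎)
    where
    open ℚᵘ.≤-Reasoning
    lemma : ∀ k d → (1ℤ ℤ.+ k) ℤ.* (d ℤ.* d) ≡ (k ℤ.* d ℤ.+ 1ℤ ℤ.* d) ℤ.* d
    lemma = ℤ-solve-∀
    eq : + suc k ℤ.* (+ (suc n ℕ.* suc n)) ≡ (+ k ℤ.* + suc n ℤ.+ 1ℤ ℤ.* + suc n) ℤ.* + suc n
    eq = ≡.trans (≡.cong (+ suc k ℤ.*_) (ℤ.pos-* (suc n) (suc n))) (lemma (+ k) (+ suc n))

  0/ : ∀ n → 0ℤ ℚ./ suc n ≡ 0ℚ
  0/ n = ℚ.toℚᵘ-injective (ℚᵘ.≃-trans (toℚᵘ-/ 0ℤ n) (ℚᵘ.*≡* ≡.refl))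

  /-nonNeg : ∀ k n → 0ℚ ℚ.≤ + k ℚ./ suc n
  /-nonNeg k n = ℚ.nonNegative⁻¹ (+ k ℚ./ suc n) {{ℚ.normalize-nonNeg k (suc n)}}

  archimedean : ∀ ε → 0ℚ ℚ.< ε → ∃ λ N → ∀ n → N ℕ.≤ n → 1ℤ ℚ./ suc n ℚ.≤ ε
  archimedean (mkℚ (+ zero) _ _) (*<* (ℤ.+<+ ()))
  archimedean (mkℚ -[1+ _ ] _ _) (*<* ())
  archimedean ε@(mkℚ (+ suc a) d-1 _) _ = suc d-1 , λ n N≤n → ℚ.toℚᵘ-cancel-≤
    (ℚᵘ.≤-respˡ-≃ (ℚᵘ.≃-sym (toℚᵘ-/ 1ℤ n)) (ℚᵘ.*≤* (ℤ.+≤+ (begin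
      1 ℕ.* suc d-1      ≡⟨ ℕ.*-identityˡ (suc d-1) ⟩
      suc d-1            ≤⟨ N≤n ⟩
      n                  ≤⟨ ℕ.n≤1+n n ⟩
      suc n              ≤⟨ ℕ.m≤n*m (suc n) (suc a) ⟩
      suc a ℕ.* suc n    ∎))))
    where open ℕ.≤-Reasoning

  above : ∀ n q → let t = + suc (suc n ℕ.* suc ℤ.∣ ↥ q ∣) ℚ./ suc n in q ℚ.< t × 1ℚ ℚ.≤ t
  above n q@(mkℚ i d-1 _) = ℚ.toℚᵘ-cancel-< (ℚᵘ.<-respʳ-≃ (ℚᵘ.≃-sym (toℚᵘ-/ (+ suc K) n)) (ℚᵘ.*<* q<t))
                          , ℚ.toℚᵘ-cancel-≤ (ℚᵘ.≤-respʳ-≃ (ℚᵘ.≃-sym (toℚᵘ-/ (+ suc K) n)) (ℚᵘ.*≤* 1≤t))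
    where
    K = suc n ℕ.* suc ℤ.∣ i ∣
    i≤∣i∣ : ∀ i → i ℤ.≤ + ℤ.∣ i ∣
    i≤∣i∣ (+ _)    = ℤ.≤-refl
    i≤∣i∣ -[1+ _ ] = ℤ.-≤+
    q<t : i ℤ.* + suc n ℤ.< + suc K ℤ.* + suc d-1
    q<t = begin-strict
      i ℤ.* + suc n              ≤⟨ ℤ.*-monoʳ-≤-nonNeg (+ suc n) (i≤∣i∣ i) ⟩
      + ℤ.∣ i ∣ ℤ.* + suc n      ≡⟨ ℤ.pos-* ℤ.∣ i ∣ (suc n) ⟨
      + (ℤ.∣ i ∣ ℕ.* suc n)      <⟨ ℤ.+<+ (ℕ.s≤s (ℕ.≤-trans (ℕ.m≤n+m _ (suc n)) (ℕ.≤-reflexive (ℕ.*-comm (suc ℤ.∣ i ∣) (suc n))))) ⟩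
      + suc K                    ≤⟨ ℤ.+≤+ (ℕ.m≤m*n (suc K) (suc d-1)) ⟩
      + (suc K ℕ.* suc d-1)      ≡⟨ ℤ.pos-* (suc K) (suc d-1) ⟩
      + suc K ℤ.* + suc d-1      ∎
      where open ℤ.≤-Reasoning
    1≤t : 1ℤ ℤ.* + suc n ℤ.≤ + suc K ℤ.* 1ℤ
    1≤t = begin
      1ℤ ℤ.* + suc n             ≡⟨ ℤ.*-identityˡ (+ suc n) ⟩
      + suc n                    ≤⟨ ℤ.+≤+ (ℕ.≤-trans (ℕ.m≤m*n (suc n) (suc ℤ.∣ i ∣)) (ℕ.n≤1+n K)) ⟩
      + suc K                    ≡⟨ ℤ.*-identityʳ (+ suc K) ⟨
      + suc K ℤ.* 1ℤ             ∎
      where open ℤ.≤-Reasoning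

√-approx-nonNeg : ∀ n q → 0ℚ ℚ.≤ √-approx n q
√-approx-nonNeg n q = /-nonNeg (√-numerator n q) n

√-approx-lower : ∀ n q → √-approx n q ≡ 0ℚ ⊎ √-approx n q ℚ.* √-approx n q ℚ.≤ q
√-approx-lower n q = Sum.map₁ (λ eq → ≡.trans (≡.cong (λ k → + k ℚ./ suc n) eq) (0/ n))
  (greatest-holds {P = √-Below n q} (√-below? n q) (suc n ℕ.* suc ℤ.∣ ↥ q ∣))

√-approx-upper : ∀ n q → let u = √-approx n q ℚ.+ (1ℤ ℚ./ suc n) in q ℚ.< u ℚ.* u
√-approx-upper n q = ≡.subst (λ u → q ℚ.< u ℚ.* u) (suc-/ (√-numerator n q) n)
  (ℚ.≰⇒> (greatest-maximal {P = √-Below n q} (√-below? n q) K (λ t²≤q → ℚ.<-irrefl ≡.refl (ℚ.<-≤-trans q<t² t²≤q))))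
  where
  K = suc n ℕ.* suc ℤ.∣ ↥ q ∣
  t = + suc K ℚ./ suc n
  q<t² : q ℚ.< t ℚ.* t
  q<t² = begin-strict
    q           <⟨ proj₁ (above n q) ⟩
    t           ≡⟨ ℚ.*-identityˡ t ⟨
    1ℚ ℚ.* t    ≤⟨ ℚ.*-monoʳ-≤-nonNeg t {{ℚ.normalize-nonNeg (suc K) (suc n)}} (proj₂ (above n q)) ⟩
    t ℚ.* t     ∎
    where open ℚ.≤-Reasoning

private
  square-expand : ∀ u δ → (u ℚ.+ δ) ℚ.* (u ℚ.+ δ) ≡ (u ℚ.* u ℚ.+ δ ℚ.* δ) ℚ.+ (u ℚ.* δ ℚ.+ u ℚ.* δ)
  square-expand = solve-∀ ℚ-ring

  *-nonNeg : ∀ {p q} → 0ℚ ℚ.≤ p → 0ℚ ℚ.≤ q → 0ℚ ℚ.≤ p ℚ.* q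
  *-nonNeg {p} {q} 0≤p 0≤q = ℚ.nonNegative⁻¹ (p ℚ.* q)
    {{ℚ.nonNeg*nonNeg⇒nonNeg p {{ℚ.nonNegative 0≤p}} q {{ℚ.nonNegative 0≤q}}}}

  p≤p+nonNeg : ∀ {p q} → 0ℚ ℚ.≤ q → p ℚ.≤ p ℚ.+ q
  p≤p+nonNeg {p} {q} 0≤q = ℚ.≤-trans (ℚ.≤-reflexive (≡.sym (ℚ.+-identityʳ p))) (ℚ.+-monoʳ-≤ p 0≤q)

  √-close : ∀ s t v p q {δ} → 0ℚ ℚ.≤ t → 0ℚ ℚ.≤ v → 0ℚ ℚ.≤ δ →
            s ≡ 0ℚ ⊎ s ℚ.* s ℚ.≤ p → q ℚ.< (t ℚ.+ v) ℚ.* (t ℚ.+ v) →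
            p ℚ.≤ q ℚ.+ δ ℚ.* δ → v ℚ.≤ δ → s ℚ.≤ t ℚ.+ (δ ℚ.+ δ)
  √-close s t v p q {δ} 0≤t 0≤v 0≤δ lower upper p≤q v≤δ with s ℚ.≤? t ℚ.+ (δ ℚ.+ δ)
  ... | yes h = h
  ... | no  h with lower
  ...   | inj₁ ≡.refl = ℚ.≤-trans 0≤t (p≤p+nonNeg (ℚ.+-mono-≤ 0≤δ 0≤δ))
  ...   | inj₂ s²≤p = ⊥-elim (ℚ.<-irrefl {s ℚ.* s} ≡.refl (begin-strict
    s ℚ.* s                         ≤⟨ s²≤p ⟩
    p                               ≤⟨ p≤q ⟩
    q ℚ.+ δ ℚ.* δ                   <⟨ ℚ.+-monoˡ-< (δ ℚ.* δ) upper ⟩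
    u ℚ.* u ℚ.+ δ ℚ.* δ             ≤⟨ p≤p+nonNeg (ℚ.+-mono-≤ (*-nonNeg 0≤u 0≤δ) (*-nonNeg 0≤u 0≤δ)) ⟩
    (u ℚ.* u ℚ.+ δ ℚ.* δ) ℚ.+ (u ℚ.* δ ℚ.+ u ℚ.* δ) ≡⟨ square-expand u δ ⟨
    (u ℚ.+ δ) ℚ.* (u ℚ.+ δ)         ≤⟨ *-mono-nonNeg 0≤u+δ (ℚ.≤-trans 0≤u+δ u+δ≤s) u+δ≤s u+δ≤s ⟩
    s ℚ.* s                         ∎))
    where
    open ℚ.≤-Reasoning
    u = t ℚ.+ v
    0≤u : 0ℚ ℚ.≤ u
    0≤u = ℚ.+-mono-≤ 0≤t 0≤v
    0≤u+δ : 0ℚ ℚ.≤ u ℚ.+ δ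
    0≤u+δ = ℚ.+-mono-≤ 0≤u 0≤δ
    u+δ≤s : u ℚ.+ δ ℚ.≤ s
    u+δ≤s = begin
      (t ℚ.+ v) ℚ.+ δ      ≤⟨ ℚ.+-monoˡ-≤ δ (ℚ.+-monoʳ-≤ t v≤δ) ⟩
      (t ℚ.+ δ) ℚ.+ δ      ≡⟨ ℚ.+-assoc t δ δ ⟩
      t ℚ.+ (δ ℚ.+ δ)      ≤⟨ ℚ.<⇒≤ (ℚ.≰⇒> h) ⟩
      s                    ∎

  √-cauchy : ∀ (s : ℕ → ℚ) {ε} (K L : ℕ) → let δ = ½ ℚ.* ε in 0ℚ ℚ.≤ δ →
             (∀ m n → K ℕ.≤ m → K ℕ.≤ n → ℚ.∣ s m ℚ.- s n ∣ ℚ.≤ δ ℚ.* δ) →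
             (∀ n → L ℕ.≤ n → 1ℤ ℚ./ suc n ℚ.≤ δ) →
             ∀ m n → K ℕ.⊔ L ℕ.≤ m → K ℕ.⊔ L ℕ.≤ n → √-approx m (s m) ℚ.≤ √-approx n (s n) ℚ.+ ε
  √-cauchy s {ε} K L 0≤δ hs hL m n N≤m N≤n = ≡.subst (λ e → √-approx m (s m) ℚ.≤ √-approx n (s n) ℚ.+ e) (½+½ ε)
    (√-close (√-approx m (s m)) (√-approx n (s n)) (1ℤ ℚ./ suc n) (s m) (s n)
      (√-approx-nonNeg n (s n)) (/-nonNeg 1 n) 0≤δ
      (√-approx-lower m (s m)) (√-approx-upper n (s n))
      (close (s m) (s n) (hs m n (ℕ.m⊔n≤o⇒m≤o K L N≤m) (ℕ.m⊔n≤o⇒m≤o K L N≤n)))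
      (hL n (ℕ.m⊔n≤o⇒n≤o K L N≤n)))

-- √ x = 0 for negative x.

√ : ℝ → ℝ
√ x = mkℝ (λ n → √-approx n (seq x n)) cauchy-√
  where
  cauchy-√ : IsCauchy (λ n → √-approx n (seq x n))
  cauchy-√ ε 0<ε =
    let δ      = ½ ℚ.* ε
        0<δ    = ½-pos 0<ε
        K , hx = cauchy x (δ ℚ.* δ) (ℚ.positive⁻¹ (δ ℚ.* δ)
                   {{ℚ.pos*pos⇒pos δ {{ℚ.positive 0<δ}} δ {{ℚ.positive 0<δ}}}})
        L , hL = archimedean δ 0<δ
        h      = √-cauchy (seq x) {ε} K L (ℚ.<⇒≤ 0<δ) hx hL
    in K ℕ.⊔ L , λ m n N≤m N≤n →
       close⁻¹ (√-approx m (seq x m)) (√-approx n (seq x n)) (h m n N≤m N≤n) (h n m N≤n N≤m)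

infix 4 _≈ℂ_
infix 5 _+i_

record ℂ : Set where
  constructor _+i_
  field
    re : ℝ
    im : ℝ

open ℂ public

_≈ℂ_ : ℂ → ℂ → Set
z ≈ℂ w = re z ≈ℝ re w × im z ≈ℝ im w

0ℂ 1ℂ : ℂ
0ℂ = fromℚ 0ℚ +i fromℚ 0ℚ
1ℂ = fromℚ 1ℚ +i fromℚ 0ℚ

infixl 6 _+ℂ_
infixl 7 _*ℂ_
infixr 7 _•ℂ_

_+ℂ_ : ℂ → ℂ → ℂ
z +ℂ w = (re z +ℝ re w) +i (im z +ℝ im w)

_*ℂ_ : ℂ → ℂ → ℂ
z *ℂ w = (re z *ℝ re w -ℝ im z *ℝ im w) +i (re z *ℝ im w +ℝ im z *ℝ re w)

_•ℂ_ : ℝ → ℂ → ℂ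
r •ℂ z = (r *ℝ re z) +i (r *ℝ im z)

∣_∣ℂ : ℂ → ℝ
∣ z ∣ℂ = √ (re z *ℝ re z +ℝ im z *ℝ im z)

sumℂ : List ℂ → ℂ
sumℂ = List.foldr _+ℂ_ 0ℂ

*ℂ-rawMonoid : RawMonoid 0ℓ 0ℓ
*ℂ-rawMonoid = record { Carrier = ℂ ; _≈_ = _≈ℂ_ ; _∙_ = _*ℂ_ ; ε = 1ℂ }

record IsFinite (S : Setoid a ℓ) : Set (a ⊔ ℓ) where
  open Setoid S
  infix 4 _≟_
  field
    _≟_        : Binary.Decidable _≈_
    elements   : List Carrier
    enumerates : IsEnumeration S elements
    unique     : Unique S elements

  card : ℕ
  card = List.length elements

record FiniteRing c ℓ : Set (Level.suc (c ⊔ ℓ)) where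
  field
    ring     : Ring c ℓ
    isFinite : IsFinite (Ring.setoid ring)

  open Ring ring public
  open IsFinite isFinite public

  field
    1≉0 : ¬ 1# ≈ 0#

  card-nonZero : ℕ.NonZero card
  card-nonZero = Fin.nonZeroIndex (index (enumerates 0#))

private
  module RingLemmas (R : Ring c ℓ) where
    open Ring R
    open RingProperties R
    open ≈-Reasoning setoid

    telescope : ∀ x y z → (x - y) + (y - z) ≈ x - z
    telescope x y z = begin
      (x - y) + (y - z)    ≈⟨ +-assoc x (- y) (y - z) ⟩
      x + (- y + (y - z))  ≈⟨ +-congˡ (+-assoc (- y) y (- z)) ⟨
      x + ((- y + y) - z)  ≈⟨ +-congˡ (+-congʳ (-‿inverseˡ y)) ⟩
      x + (0# - z)         ≈⟨ +-congˡ (+-identityˡ (- z)) ⟩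
      x - z                ∎

    exchange : ∀ x y u v → (x + u) - (y + v) ≈ (x - y) + (u - v)
    exchange x y u v = begin
      (x + u) - (y + v)      ≈⟨ +-congˡ (-‿+-comm y v) ⟨
      (x + u) + (- y - v)    ≈⟨ +-assoc x u (- y - v) ⟩
      x + (u + (- y - v))    ≈⟨ +-congˡ (+-assoc u (- y) (- v)) ⟨
      x + ((u - y) - v)      ≈⟨ +-congˡ (+-congʳ (+-comm u (- y))) ⟩
      x + ((- y + u) - v)    ≈⟨ +-congˡ (+-assoc (- y) u (- v)) ⟩
      x + (- y + (u - v))    ≈⟨ +-assoc x (- y) (u - v) ⟨
      (x - y) + (u - v)      ∎

    x≈y+[x-y] : ∀ x y → x ≈ y + (x - y)
    x≈y+[x-y] x y = begin
      x               ≈⟨ +-identityʳ x ⟨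
      x + 0#          ≈⟨ +-congˡ (-‿inverseˡ y) ⟨
      x + (- y + y)   ≈⟨ +-assoc x (- y) y ⟨
      (x - y) + y     ≈⟨ +-comm (x - y) y ⟩
      y + (x - y)     ∎

module _ (R : FiniteRing c ℓ) where

  open FiniteRing R

  -- Every subset of a finite set is classically decidable, so one-sided ideals
  -- are given by characteristic functions.  The Jacobson radical is the
  -- intersection of the maximal left ideals.

  record IsLeftIdeal (I : Carrier → Bool) : Set (c ⊔ ℓ) where
    field
      resp : ∀ {x y} → x ≈ y → T (I x) → T (I y)
      0∈   : T (I 0#)
      +∈   : ∀ {x y} → T (I x) → T (I y) → T (I (x + y))
      *∈   : ∀ r {x} → T (I x) → T (I (r * x))

  record IsMaximalLeftIdeal (M : Carrier → Bool) : Set (c ⊔ ℓ) where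
    field
      isLeftIdeal : IsLeftIdeal M
      proper      : ¬ T (M 1#)
      maximal     : ∀ I → IsLeftIdeal I → (∀ x → T (M x) → T (I x)) →
                    (∀ x → T (I x) → T (M x)) ⊎ (∀ x → T (I x))

  JacobsonRadical : Pred Carrier (c ⊔ ℓ)
  JacobsonRadical x = ∀ M → IsMaximalLeftIdeal M → T (M x)

  record IsIdeal (I : Pred Carrier p) : Set (c ⊔ ℓ ⊔ p) where
    field
      resp : ∀ {x y} → x ≈ y → I x → I y
      0∈   : I 0#
      +∈   : ∀ {x y} → I x → I y → I (x + y)
      *∈   : ∀ r {x} → I x → I (r * x)
      ∈*   : ∀ {x} r → I x → I (x * r)

  module _ (I : Pred Carrier p) (isIdeal : IsIdeal I) (I? : Decidable I) (1∉I : ¬ I 1#) where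

    private
      open IsIdeal isIdeal
      open RingProperties ring using (-1*x≈-x; ⁻¹-anti-homo‿-; x[y-z]≈xy-xz; [y-z]x≈yx-zx; -‿+-comm; -0#≈0#)
      open RingLemmas ring
      open ≈-Reasoning setoid

      infix 4 _∼_
      _∼_ : Carrier → Carrier → Set _
      x ∼ y = I (x - y)

      -∈ : ∀ {x} → I x → I (- x)
      -∈ {x} h = resp (-1*x≈-x x) (*∈ (- 1#) h)

      ∼-reflexive : ∀ {x y} → x ≈ y → x ∼ y
      ∼-reflexive {x} {y} x≈y = resp (begin
        0#     ≈⟨ -‿inverseʳ y ⟨
        y - y  ≈⟨ +-congʳ x≈y ⟨
        x - y  ∎) 0∈

      ∼-sym : ∀ {x y} → x ∼ y → y ∼ x
      ∼-sym {x} {y} h = resp (⁻¹-anti-homo‿- x y) (-∈ h)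

      ∼-trans : ∀ {x y z} → x ∼ y → y ∼ z → x ∼ z
      ∼-trans {x} {y} {z} h k = resp (telescope x y z) (+∈ h k)

      ∼-+-cong : ∀ {x y u v} → x ∼ y → u ∼ v → x + u ∼ y + v
      ∼-+-cong {x} {y} {u} {v} h k = resp (sym (exchange x y u v)) (+∈ h k)

      ∼-*-cong : ∀ {x y u v} → x ∼ y → u ∼ v → x * u ∼ y * v
      ∼-*-cong {x} {y} {u} {v} h k = ∼-trans
        (resp ([y-z]x≈yx-zx u x y) (∈* u h))
        (resp (x[y-z]≈xy-xz y u v) (*∈ y k))

      ∼-neg-cong : ∀ {x y} → x ∼ y → - x ∼ - y
      ∼-neg-cong {x} {y} h = resp (sym (-‿+-comm x (- y))) (-∈ h)

    quotientRing : Ring c p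
    quotientRing = record
      { Carrier = Carrier
      ; _≈_     = _∼_
      ; _+_     = _+_
      ; _*_     = _*_
      ; -_      = -_
      ; 0#      = 0#
      ; 1#      = 1#
      ; isRing  = record
        { +-isAbelianGroup = record
          { isGroup = record
            { isMonoid = record
              { isSemigroup = record
                { isMagma = record
                  { isEquivalence = record
                    { refl  = ∼-reflexive refl
                    ; sym   = ∼-sym
                    ; trans = ∼-trans
                    }
                  ; ∙-cong = ∼-+-cong
                  }
                ; assoc = λ x y z → ∼-reflexive (+-assoc x y z)
                }
              ; identity = (λ x → ∼-reflexive (+-identityˡ x)) , (λ x → ∼-reflexive (+-identityʳ x))
              }
            ; inverse = (λ x → ∼-reflexive (-‿inverseˡ x)) , (λ x → ∼-reflexive (-‿inverseʳ x))
            ; ⁻¹-cong = ∼-neg-cong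
            }
          ; comm = λ x y → ∼-reflexive (+-comm x y)
          }
        ; *-cong     = ∼-*-cong
        ; *-assoc    = λ x y z → ∼-reflexive (*-assoc x y z)
        ; *-identity = (λ x → ∼-reflexive (*-identityˡ x)) , (λ x → ∼-reflexive (*-identityʳ x))
        ; distrib    = (λ x y z → ∼-reflexive (distribˡ x y z)) , (λ x y z → ∼-reflexive (distribʳ x y z))
        }
      }

    private
      quotientDecSetoid : DecSetoid c p
      quotientDecSetoid = record
        { isDecEquivalence = record
          { isEquivalence = Ring.isEquivalence quotientRing
          ; _≟_           = λ x y → I? (x - y)
          }
        }

    quotient : FiniteRing c p
    quotient = record
      { ring     = quotientRing
      ; isFinite = record
        { _≟_        = λ x y → I? (x - y)
        ; elements   = List.deduplicate (λ x y → I? (x - y)) elements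
        ; enumerates = deduplicate⁺ quotientDecSetoid (λ x → Any.map ∼-reflexive (enumerates x))
        ; unique     = deduplicate-! quotientDecSetoid elements
        }
      ; 1≉0 = λ 1∼0 → 1∉I (resp (trans (+-congˡ -0#≈0#) (+-identityʳ 1#)) 1∼0)
      }

-- The Jacobson radical of a finite ring is a proper decidable ideal: x lies
-- in it exactly when 1 - r x has a left inverse for every r.

module _ (R : FiniteRing c ℓ) where

  open FiniteRing R

  private
    open RingProperties ring
    open RingLemmas ring
    open ≈-Reasoning setoid

    any? : {P : Pred Carrier p} → P Respects _≈_ → Decidable P → Dec (∃ P)
    any? resp P? with Any.any? P? elements
    ... | yes h = yes (Any.satisfied h)
    ... | no ¬h = no λ (x , Px) → ¬h (Any.map (λ x≈y → resp x≈y Px) (enumerates x))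

    all? : {P : Pred Carrier p} → P Respects _≈_ → Decidable P → Dec (∀ x → P x)
    all? {P = P} resp P? with any? (λ x≈y ¬Px Py → ¬Px (resp (sym x≈y) Py)) (λ x → ¬? (P? x))
    ... | yes (x , ¬Px) = no λ h → ¬Px (h x)
    ... | no ∄          = yes λ x → decidable-stable (P? x) (λ ¬Px → ∄ (x , ¬Px))

    module LeftIdeal {I : Carrier → Bool} (isLeftIdeal : IsLeftIdeal R I) where
      open IsLeftIdeal isLeftIdeal public

      1∈⇒all : T (I 1#) → ∀ x → T (I x)
      1∈⇒all h x = resp (*-identityʳ x) (*∈ x h)

    module Extend {I : Carrier → Bool} (isLeftIdeal : IsLeftIdeal R I) (y : Carrier) where
      open LeftIdeal isLeftIdeal

      member? : ∀ z → Dec (∃ λ t → T (I (z - t * y)))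
      member? z = any? (λ s≈t → resp (+-congˡ (-‿cong (*-congʳ s≈t)))) (λ t → T? (I (z - t * y)))

      I+Ry : Carrier → Bool
      I+Ry z = isYes (member? z)

      I⊆I+Ry : ∀ x → T (I x) → T (I+Ry x)
      I⊆I+Ry x h = fromWitness (0# , resp (sym (begin
        x - 0# * y   ≈⟨ +-congˡ (-‿cong (zeroˡ y)) ⟩
        x - 0#       ≈⟨ +-congˡ -0#≈0# ⟩
        x + 0#       ≈⟨ +-identityʳ x ⟩
        x            ∎)) h)

      y∈I+Ry : T (I+Ry y)
      y∈I+Ry = fromWitness (1# , resp (sym (begin
        y - 1# * y   ≈⟨ +-congˡ (-‿cong (*-identityˡ y)) ⟩
        y - y        ≈⟨ -‿inverseʳ y ⟩
        0#           ∎)) 0∈)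

      isLeftIdeal-I+Ry : IsLeftIdeal R I+Ry
      isLeftIdeal-I+Ry = record
        { resp = λ x≈z h → let t , k = toWitness h in fromWitness (t , resp (+-congʳ x≈z) k)
        ; 0∈   = I⊆I+Ry 0# 0∈
        ; +∈   = λ {u} {v} h k → let s , hs = toWitness h
                                     t , kt = toWitness k
                                 in fromWitness (s + t , resp (sym (begin
            (u + v) - (s + t) * y        ≈⟨ +-congˡ (-‿cong (distribʳ y s t)) ⟩
            (u + v) - (s * y + t * y)    ≈⟨ exchange u (s * y) v (t * y) ⟩
            (u - s * y) + (v - t * y)    ∎)) (+∈ hs kt))
        ; *∈   = λ r {u} h → let s , hs = toWitness h in fromWitness (r * s , resp (begin
            r * (u - s * y)        ≈⟨ x[y-z]≈xy-xz r u (s * y) ⟩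
            r * u - r * (s * y)    ≈⟨ +-congˡ (-‿cong (*-assoc r s y)) ⟨
            r * u - (r * s) * y    ∎) (*∈ r hs))
        }

    -- A proper left ideal lies in a maximal one, by induction on the number
    -- of elements outside it.

    ¬¬maximal : ∀ k {I} → IsLeftIdeal R I → ¬ T (I 1#) →
                ∀ ys → (∀ x → T (I x) ⊎ Membership._∈_ setoid x ys) → List.length ys ℕ.≤ k →
                (∀ M → IsMaximalLeftIdeal R M → (∀ x → T (I x) → T (M x)) → ⊥) → ⊥
    ¬¬maximal k {I} isLeftIdeal proper ys outside ∣ys∣≤k none =
      none I record { isLeftIdeal = isLeftIdeal ; proper = proper ; maximal = maximal } (λ _ h → h)
      where
      maximal : ∀ I′ → IsLeftIdeal R I′ → (∀ x → T (I x) → T (I′ x)) →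
                (∀ x → T (I′ x) → T (I x)) ⊎ (∀ x → T (I′ x))
      maximal I′ isLeftIdeal′ I⊆I′ with T? (I′ 1#)
      ... | yes 1∈I′ = inj₂ (LeftIdeal.1∈⇒all isLeftIdeal′ 1∈I′)
      ... | no  1∉I′
        with any? (λ x≈y (h , ¬h) → IsLeftIdeal.resp isLeftIdeal′ x≈y h
                                  , λ h′ → ¬h (IsLeftIdeal.resp isLeftIdeal (sym x≈y) h′))
                  (λ x → T? (I′ x) ×-dec ¬? (T? (I x)))
      ...   | no ∄ = inj₁ λ x h → decidable-stable (T? (I x)) (λ ¬h → ∄ (x , h , ¬h))
      ...   | yes (z , z∈I′ , z∉I) = ⊥-elim (smaller k ∣ys∣≤k)
        where
        P? : Decidable (λ x → ¬ T (I′ x))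
        P? x = ¬? (T? (I′ x))

        z∈ys : Membership._∈_ setoid z ys
        z∈ys with outside z
        ... | inj₁ z∈I = ⊥-elim (z∉I z∈I)
        ... | inj₂ h   = h

        shorter : List.length (List.filter P? ys) ℕ.< List.length ys
        shorter = filter-notAll P? ys
          (Any.map (λ z≈y ¬h → ¬h (IsLeftIdeal.resp isLeftIdeal′ z≈y z∈I′)) z∈ys)

        outside′ : ∀ x → T (I′ x) ⊎ Membership._∈_ setoid x (List.filter P? ys)
        outside′ x with T? (I′ x) | outside x
        ... | yes h | _      = inj₁ h
        ... | no ¬h | inj₁ h = inj₁ (I⊆I′ x h)
        ... | no ¬h | inj₂ h = inj₂ (∈-filter⁺ setoid P?
          (λ x≈y ¬h h → ¬h (IsLeftIdeal.resp isLeftIdeal′ (sym x≈y) h)) h ¬h)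

        smaller : ∀ k → List.length ys ℕ.≤ k → ⊥
        smaller zero     h = ℕ.n≮0 (ℕ.<-≤-trans shorter h)
        smaller (suc k′) h = ¬¬maximal k′ isLeftIdeal′ 1∉I′ (List.filter P? ys) outside′
          (ℕ.s≤s⁻¹ (ℕ.≤-trans shorter h)) (λ M isMax I′⊆M → none M isMax (λ x h → I′⊆M x (I⊆I′ x h)))

    Zero : Carrier → Bool
    Zero x = isYes (x ≟ 0#)

    isLeftIdeal-Zero : IsLeftIdeal R Zero
    isLeftIdeal-Zero = record
      { resp = λ x≈y h → fromWitness (trans (sym x≈y) (toWitness h))
      ; 0∈   = fromWitness refl
      ; +∈   = λ h k → fromWitness (trans (+-cong (toWitness h) (toWitness k)) (+-identityˡ 0#))
      ; *∈   = λ r h → fromWitness (trans (*-congˡ (toWitness h)) (zeroʳ r))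
      }

    ¬¬maximal′ : ∀ {I} → IsLeftIdeal R I → ¬ T (I 1#) →
                 (∀ M → IsMaximalLeftIdeal R M → (∀ x → T (I x) → T (M x)) → ⊥) → ⊥
    ¬¬maximal′ isLeftIdeal proper =
      ¬¬maximal card isLeftIdeal proper elements (λ x → inj₂ (enumerates x)) ℕ.≤-refl

    LeftInvertible : Pred Carrier _
    LeftInvertible u = ∃ λ s → s * u ≈ 1#

    leftInvertible? : Decidable LeftInvertible
    leftInvertible? u = any? (λ s≈t eq → trans (*-congʳ (sym s≈t)) eq) (λ s → s * u ≟ 1#)

    LeftInvertible-resp : LeftInvertible Respects _≈_
    LeftInvertible-resp u≈v (s , eq) = s , trans (*-congˡ (sym u≈v)) eq

    QuasiRegular : Pred Carrier _
    QuasiRegular x = ∀ r → LeftInvertible (1# - r * x)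

    quasiRegular? : Decidable QuasiRegular
    quasiRegular? x = all?
      (λ r≈s → LeftInvertible-resp (+-congˡ (-‿cong (*-congʳ r≈s))))
      (λ r → leftInvertible? (1# - r * x))

    J⇒quasiRegular : ∀ {x} → JacobsonRadical R x → QuasiRegular x
    J⇒quasiRegular {x} x∈J r with leftInvertible? (1# - r * x)
    ... | yes h = h
    ... | no ¬h = ⊥-elim (¬¬maximal′ isLeftIdeal-I+Ry proper λ M isMax I⊆M →
        let open IsMaximalLeftIdeal isMax using (isLeftIdeal) renaming (proper to 1∉M)
            open IsLeftIdeal isLeftIdeal
        in 1∉M (resp (sym (x≈y+[x-y] 1# (r * x))) (+∈ (*∈ r (x∈J M isMax)) (I⊆M _ y∈I+Ry))))
      where
      open Extend isLeftIdeal-Zero (1# - r * x)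

      proper : ¬ T (I+Ry 1#)
      proper h = let t , k = toWitness h in ¬h (t , sym (x∙y⁻¹≈ε⇒x≈y _ _ (toWitness k)))

    quasiRegular⇒J : ∀ {x} → QuasiRegular x → JacobsonRadical R x
    quasiRegular⇒J {x} qr M isMax with T? (M x)
    ... | yes h = h
    ... | no ¬h = ⊥-elim (contra (maximal I+Ry isLeftIdeal-I+Ry I⊆I+Ry))
      where
      open IsMaximalLeftIdeal isMax
      open Extend isLeftIdeal x
      open IsLeftIdeal isLeftIdeal

      contra : ¬ ((∀ z → T (I+Ry z) → T (M z)) ⊎ (∀ z → T (I+Ry z)))
      contra (inj₁ h) = ¬h (h x y∈I+Ry)
      contra (inj₂ h) =
        let t , k  = toWitness (h 1#)
            s , eq = qr t
        in proper (resp eq (*∈ s k))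

    -- If u (1 - r a) = 1 then (1 + a u r) (1 - a r) = 1.

    flip-inverse : ∀ r a u → u * (1# - r * a) ≈ 1# → (1# + a * u * r) * (1# - a * r) ≈ 1#
    flip-inverse r a u eq = begin
      (1# + a * u * r) * (1# - a * r)                  ≈⟨ distribʳ _ 1# (a * u * r) ⟩
      1# * (1# - a * r) + a * u * r * (1# - a * r)     ≈⟨ +-cong (*-identityˡ _) (*-assoc (a * u) r _) ⟩
      (1# - a * r) + a * u * (r * (1# - a * r))        ≈⟨ +-congˡ (*-congˡ commute) ⟩
      (1# - a * r) + a * u * ((1# - r * a) * r)        ≈⟨ +-congˡ (*-assoc a u _) ⟩
      (1# - a * r) + a * (u * ((1# - r * a) * r))      ≈⟨ +-congˡ (*-congˡ (*-assoc u _ r)) ⟨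
      (1# - a * r) + a * (u * (1# - r * a) * r)        ≈⟨ +-congˡ (*-congˡ (*-congʳ eq)) ⟩
      (1# - a * r) + a * (1# * r)                      ≈⟨ +-congˡ (*-congˡ (*-identityˡ r)) ⟩
      (1# - a * r) + a * r                             ≈⟨ +-comm _ (a * r) ⟩
      a * r + (1# - a * r)                             ≈⟨ x≈y+[x-y] 1# (a * r) ⟨
      1#                                               ∎
      where
      commute : r * (1# - a * r) ≈ (1# - r * a) * r
      commute = begin
        r * (1# - a * r)          ≈⟨ x[y-z]≈xy-xz r 1# (a * r) ⟩
        r * 1# - r * (a * r)      ≈⟨ +-cong (trans (*-identityʳ r) (sym (*-identityˡ r))) (-‿cong (sym (*-assoc r a r))) ⟩
        1# * r - r * a * r        ≈⟨ [y-z]x≈yx-zx r 1# (r * a) ⟨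
        (1# - r * a) * r          ∎

  isIdeal-J : IsIdeal R (JacobsonRadical R)
  isIdeal-J = record
    { resp = λ x≈y h M isMax → resp (isLeftIdeal isMax) x≈y (h M isMax)
    ; 0∈   = λ M isMax → 0∈ (isLeftIdeal isMax)
    ; +∈   = λ h k M isMax → +∈ (isLeftIdeal isMax) (h M isMax) (k M isMax)
    ; *∈   = λ r h M isMax → *∈ (isLeftIdeal isMax) r (h M isMax)
    ; ∈*   = λ {x} r h → quasiRegular⇒J λ s →
               let u , eq = J⇒quasiRegular h (r * s)
               in LeftInvertible-resp (+-congˡ (-‿cong (*-assoc s x r)))
                    (_ , flip-inverse r (s * x) u
                           (trans (*-congˡ (+-congˡ (-‿cong (sym (*-assoc r s x))))) eq))
    }
    where
    open IsLeftIdeal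
    open IsMaximalLeftIdeal

  J? : Decidable (JacobsonRadical R)
  J? x = map′ quasiRegular⇒J J⇒quasiRegular (quasiRegular? x)

  1∉J : ¬ JacobsonRadical R 1#
  1∉J h = ¬¬maximal′ isLeftIdeal-Zero (λ 1∈0 → 1≉0 (toWitness 1∈0))
    (λ M isMax _ → IsMaximalLeftIdeal.proper isMax (h M isMax))

  semisimplePart : FiniteRing c (c ⊔ ℓ)
  semisimplePart = quotient R (JacobsonRadical R) isIdeal-J J? 1∉J

  ∣J∣ : ℕ
  ∣J∣ = List.length (List.filter J? elements)

-- A ℤ-linear combination of words; a word may be listed several times.

ℤ⟨X⟩ : ℕ → Set
ℤ⟨X⟩ n = List (ℤ × List (Fin n))

constantTerm : ∀ {n} → ℤ⟨X⟩ n → ℤ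
constantTerm []                  = 0ℤ
constantTerm ((k , [])    ∷ f) = k ℤ.+ constantTerm f
constantTerm ((k , _ ∷ _) ∷ f) = constantTerm f

module _ (R : FiniteRing c ℓ) where

  open FiniteRing R
  open RawMonoidDefinitions +-rawMonoid using () renaming (_×_ to _×ℕ_)

  infixr 7 _•_
  _•_ : ℤ → Carrier → Carrier
  + n      • x = n ×ℕ x
  -[1+ n ] • x = - (suc n ×ℕ x)

  evalWord : ∀ {n} → List (Fin n) → Vector Carrier n → Carrier
  evalWord w x = List.foldr (λ i y → x i * y) 1# w

  eval : ∀ {n} → ℤ⟨X⟩ n → Vector Carrier n → Carrier
  eval f x = List.foldr (λ (k , w) y → k • evalWord w x + y) 0# f

  infixr 8 ⟨R⟩^_
  ⟨R⟩^_ : ℕ → AbelianGroup c ℓ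
  ⟨R⟩^ d = Pointwise.abelianGroup (Fin d) +-abelianGroup

  points : ∀ d → List (Vector Carrier d)
  points zero    = Vector.[] ∷ []
  points (suc d) = List.cartesianProductWith Vector._∷_ elements (points d)

  -- A multiplicative map out of a group takes values in ℂˣ, and so in the
  -- unit circle when the group is finite.

  record Character (d : ℕ) : Set (c ⊔ ℓ) where
    open MonoidMorphisms (AbelianGroup.rawMonoid (⟨R⟩^ d)) *ℂ-rawMonoid
    field
      ⟦_⟧            : Vector Carrier d → ℂ
      isHomomorphism : IsMonoidHomomorphism ⟦_⟧

  open Character

  IsTrivial : ∀ {d} → Character d → Set c
  IsTrivial ψ = ∀ x → ⟦ ψ ⟧ x ≈ℂ 1ℂ

  1/∣R∣^ : ℕ → ℝ
  1/∣R∣^ d = fromℚ (1ℤ ℚ./ (card ℕ.^ d))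
    where instance
      ∣R∣^d≢0 : ℕ.NonZero (card ℕ.^ d)
      ∣R∣^d≢0 = ℕ.m^n≢0 card d {{card-nonZero}}

  module _ {d} {T : Pred (Vector Carrier d) p} (T? : Decidable T) where

    members : List (Vector Carrier d)
    members = List.filter T? (points d)

    ∣T∣ : ℕ
    ∣T∣ = List.length members

    fourier : Character d → ℂ
    fourier ψ = 1/∣R∣^ d •ℂ sumℂ (List.map ⟦ ψ ⟧ members)

    IsSalem : ℝ → Set (c ⊔ ℓ)
    IsSalem C = ∀ ψ → ¬ IsTrivial ψ → ∣ fourier ψ ∣ℂ ≤ℝ C *ℝ 1/∣R∣^ d *ℝ √ (fromℕ ∣T∣)

  module _ {n} (f : ℤ⟨X⟩ n) (k : ℤ) where

    V : Pred (Vector Carrier (suc n)) ℓ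
    V x = Vector.last x ≈ eval f (Vector.init x) + k • 1#

    V? : Decidable V
    V? x = Vector.last x ≟ (eval f (Vector.init x) + k • 1#)

    IsSalemNumber : ℝ → Set (c ⊔ ℓ)
    IsSalemNumber C = IsSalem V? C × (∀ C′ → IsSalem V? C′ → C ≤ℝ C′)

{-# OPTIONS --safe #-}

-- The fibres of V_{f,c}(R) → V_{f,c}(R/J) all have |J|^(d-1) elements, because the
-- first d - 1 coordinates of a point determine the last.  Hence for a nontrivial
-- character ψ of (R/J)^d, lifted to R^d, the sum of ψ over V_{f,c}(R) is |J|^(d-1)
-- times its sum over V_{f,c}(R/J), and |V_{f,c}(R)| = |J|^(d-1) |V_{f,c}(R/J)|.
-- The bound for the lift of ψ therefore shows that V_{f,c}(R/J) is C-Salem with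
-- C = C_R |J|^(-(d-1)/2), and C_S ≤ C by minimality.

module Submission where

open import Defs
open import Algebra.Bundles using (CommutativeMonoid)
open import Algebra.Definitions.RawMonoid using () renaming (_×_ to multiple)
open import Algebra.Morphism.Structures using (module MonoidMorphisms)
import Algebra.Properties.AbelianGroup as AbelianGroupProperties
import Algebra.Properties.CommutativeMonoid.Mult as Mult
import Algebra.Properties.CommutativeSemigroup as CommutativeSemigroupProperties
open import Data.Bool.Base using (if_then_else_)
open import Data.Empty using (⊥-elim)
import Data.Fin.Properties as Fin
open import Data.Fin.Base using (zero; suc)
open import Data.Integer.Base as ℤ using (ℤ; 0ℤ; 1ℤ)
import Data.Integer.Properties as ℤ
open import Data.List.Base as List using (List; []; _∷_; _++_)
import Data.List.Membership.Setoid as Membership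
open import Data.List.Membership.Setoid.Properties using (∈-filter⁺)
open import Data.List.Relation.Unary.All as All using (All; []; _∷_)
open import Data.List.Relation.Unary.AllPairs using (_∷_)
open import Data.List.Relation.Unary.Any using (here; index; there)
open import Data.List.Relation.Unary.Unique.Setoid using (Unique)
open import Data.Nat.Base as ℕ using (ℕ; zero; suc; _≤_; _^_)
import Data.Nat.Properties as ℕ
open import Data.Product.Base as Product using (∃; _,_; proj₁)
open import Data.Rational.Base as ℚ using (ℚ; mkℚ; 0ℚ; 1ℚ; ½; *<*)
import Data.Rational.Properties as ℚ
import Data.Rational.Unnormalised.Base as ℚᵘ
import Data.Rational.Unnormalised.Properties as ℚᵘ
open import Data.Sum.Base using (_⊎_; inj₁; inj₂)
open import Data.Vec.Functional as Vector using (Vector)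
open import Function.Base using (_∘_)
open import Level using (Level; 0ℓ; _⊔_)
open import Relation.Binary.Bundles using (Preorder; Setoid)
open import Relation.Binary.PropositionalEquality as ≡ using (_≡_)
import Relation.Binary.Reasoning.Preorder as ≲-Reasoning
import Relation.Binary.Reasoning.Setoid as ≈-Reasoning
open import Relation.Nullary using (¬_; Dec; does; no; yes)
open import Relation.Nullary.Decidable using (dec⇒maybe)
open import Relation.Unary using (Decidable; Pred)
open import Tactic.RingSolver using (solve-∀)
open import Tactic.RingSolver.Core.AlmostCommutativeRing using (AlmostCommutativeRing; fromCommutativeRing)

private
  variable
    a b ℓ p p′ : Level
    A B D : Set a
    P : Set p
    Q : Set p′


-- Finite sums

module Sum {c ℓ} (M : CommutativeMonoid c ℓ) where
  open CommutativeMonoid M public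
  open Mult M public using (_×_; ×-congʳ; ×-assocˡ)
  open CommutativeSemigroupProperties commutativeSemigroup using (interchange)
  open ≈-Reasoning setoid

  ∑ : (A → Carrier) → List A → Carrier
  ∑ h xs = List.foldr _∙_ ε (List.map h xs)

  [_]_ : Dec P → Carrier → Carrier
  [ d ] x = if does d then x else ε

  infixr 8 [_]_

  []-yes : (d : Dec P) {x : Carrier} → P → [ d ] x ≈ x
  []-yes (yes _) _ = refl
  []-yes (no ¬p) p = ⊥-elim (¬p p)

  []-no : (d : Dec P) {x : Carrier} → ¬ P → [ d ] x ≈ ε
  []-no (yes p) ¬p = ⊥-elim (¬p p)
  []-no (no _)  _  = refl

  []-cong : (d : Dec P) (e : Dec Q) {x y : Carrier} →
            (P → Q) → (Q → P) → (P → x ≈ y) → [ d ] x ≈ [ e ] y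
  []-cong d (yes q) _ g h = trans ([]-yes d (g q)) (h (g q))
  []-cong d (no ¬q) f _ _ = []-no d (¬q ∘ f)

  ∑-cong : {g h : A → Carrier} → (∀ x → g x ≈ h x) → ∀ xs → ∑ g xs ≈ ∑ h xs
  ∑-cong g≈h []       = refl
  ∑-cong g≈h (x ∷ xs) = ∙-cong (g≈h x) (∑-cong g≈h xs)

  ∑-ε : (xs : List A) → ∑ (λ _ → ε) xs ≈ ε
  ∑-ε []       = refl
  ∑-ε (x ∷ xs) = trans (identityˡ _) (∑-ε xs)

  ∑-∙ : (g h : A → Carrier) → ∀ xs → ∑ (λ x → g x ∙ h x) xs ≈ ∑ g xs ∙ ∑ h xs
  ∑-∙ g h []       = sym (identityˡ ε)
  ∑-∙ g h (x ∷ xs) = trans (∙-congˡ (∑-∙ g h xs)) (interchange (g x) (h x) _ _)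

  ∑-comm : (g : A → B → Carrier) → ∀ xs ys →
           ∑ (λ x → ∑ (g x) ys) xs ≈ ∑ (λ y → ∑ (λ x → g x y) xs) ys
  ∑-comm g []       ys = sym (∑-ε ys)
  ∑-comm g (x ∷ xs) ys = begin
    ∑ (g x) ys ∙ ∑ (λ x → ∑ (g x) ys) xs          ≈⟨ ∙-congˡ (∑-comm g xs ys) ⟩
    ∑ (g x) ys ∙ ∑ (λ y → ∑ (λ x → g x y) xs) ys  ≈⟨ ∑-∙ (g x) _ ys ⟨
    ∑ (λ y → g x y ∙ ∑ (λ x → g x y) xs) ys       ∎

  ∑-× : ∀ n (h : A → Carrier) xs → ∑ (λ x → n × h x) xs ≈ n × ∑ h xs
  ∑-× zero    h xs = ∑-ε xs
  ∑-× (suc n) h xs = trans (∑-∙ h (λ x → n × h x) xs) (∙-congˡ (∑-× n h xs))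

  ∑-++ : (h : A → Carrier) → ∀ xs ys → ∑ h (xs ++ ys) ≈ ∑ h xs ∙ ∑ h ys
  ∑-++ h []       ys = sym (identityˡ _)
  ∑-++ h (x ∷ xs) ys = trans (∙-congˡ (∑-++ h xs ys)) (sym (assoc (h x) _ _))

  ∑-map : (h : B → Carrier) (f : A → B) → ∀ xs → ∑ h (List.map f xs) ≈ ∑ (h ∘ f) xs
  ∑-map h f []       = refl
  ∑-map h f (x ∷ xs) = ∙-congˡ (∑-map h f xs)

  ∑-cartesianProductWith : (h : D → Carrier) (f : A → B → D) → ∀ xs ys →
    ∑ h (List.cartesianProductWith f xs ys) ≈ ∑ (λ x → ∑ (h ∘ f x) ys) xs
  ∑-cartesianProductWith h f []       ys = refl
  ∑-cartesianProductWith h f (x ∷ xs) ys = trans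
    (∑-++ h (List.map (f x) ys) _)
    (∙-cong (∑-map h (f x) ys) (∑-cartesianProductWith h f xs ys))

  ∑-filter : {P : Pred A p} (P? : Decidable P) (h : A → Carrier) → ∀ xs →
             ∑ h (List.filter P? xs) ≈ ∑ (λ x → [ P? x ] h x) xs
  ∑-filter P? h []       = refl
  ∑-filter P? h (x ∷ xs) with P? x
  ... | yes _ = ∙-congˡ (∑-filter P? h xs)
  ... | no  _ = trans (∑-filter P? h xs) (sym (identityˡ _))

  ∑-[]-× : {P : Pred A p} (P? : Decidable P) (z : Carrier) → ∀ xs →
           ∑ (λ x → [ P? x ] z) xs ≈ List.length (List.filter P? xs) × z
  ∑-[]-× P? z []       = refl
  ∑-[]-× P? z (x ∷ xs) with P? x
  ... | yes _ = ∙-congˡ (∑-[]-× P? z xs)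
  ... | no  _ = trans (identityˡ _) (∑-[]-× P? z xs)

  ∑-none : {P : Pred A p} (P? : Decidable P) (h : A → Carrier) → ∀ {xs} →
           All (¬_ ∘ P) xs → ∑ (λ x → [ P? x ] h x) xs ≈ ε
  ∑-none P? h []                  = refl
  ∑-none P? h {x ∷ _} (¬px ∷ ¬pxs) = trans
    (∙-cong ([]-no (P? x) ¬px) (∑-none P? h ¬pxs)) (identityˡ ε)

  module _ (S : Setoid a b) (isFinite : IsFinite S) where
    private module S = Setoid S
    open IsFinite isFinite

    ∑-δ : (h : S.Carrier → Carrier) → (∀ {x y} → x S.≈ y → h x ≈ h y) → ∀ t →
          ∑ (λ x → [ x ≟ t ] h x) elements ≈ h t
    ∑-δ h h-cong t = go unique (enumerates t)
      where
      go : ∀ {xs} → Unique S xs → Membership._∈_ S t xs → ∑ (λ x → [ x ≟ t ] h x) xs ≈ h t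
      go {x ∷ xs} (x# ∷ _) (here t≈x) = begin
        [ x ≟ t ] h x ∙ ∑ (λ y → [ y ≟ t ] h y) xs ≈⟨ ∙-cong ([]-yes (x ≟ t) (S.sym t≈x))
                                                        (∑-none (_≟ t) h (All.map (λ x≉y y≈t → x≉y (S.trans (S.sym t≈x) (S.sym y≈t))) x#)) ⟩
        h x ∙ ε                                    ≈⟨ identityʳ (h x) ⟩
        h x                                        ≈⟨ h-cong t≈x ⟨
        h t                                        ∎
      go {x ∷ xs} (x# ∷ xs!) (there t∈xs) = begin
        [ x ≟ t ] h x ∙ ∑ (λ y → [ y ≟ t ] h y) xs ≈⟨ ∙-cong ([]-no (x ≟ t) (λ x≈t → All.lookupₛ S (λ y≈z x≉y x≈z → x≉y (S.trans x≈z (S.sym y≈z))) x# t∈xs x≈t)) (go xs! t∈xs) ⟩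
        ε ∙ h t                                    ≈⟨ identityˡ (h t) ⟩
        h t                                        ∎

    -- Writing h (f x) as a sum of h y over the y with y ≈ f x and exchanging the
    -- sums counts the fibres of f, which are those of g.
    ∑-bijection : (f g : S.Carrier → S.Carrier) →
      (∀ {x y} → y S.≈ f x → x S.≈ g y) → (∀ {x y} → x S.≈ g y → y S.≈ f x) →
      (h : S.Carrier → Carrier) → (∀ {x y} → x S.≈ y → h x ≈ h y) →
      ∑ (h ∘ f) elements ≈ ∑ h elements
    ∑-bijection f g f⇒g g⇒f h h-cong = begin
      ∑ (h ∘ f) elements
        ≈⟨ ∑-cong (λ x → ∑-δ h h-cong (f x)) elements ⟨
      ∑ (λ x → ∑ (λ y → [ y ≟ f x ] h y) elements) elements
        ≈⟨ ∑-comm _ elements elements ⟩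
      ∑ (λ y → ∑ (λ x → [ y ≟ f x ] h y) elements) elements
        ≈⟨ ∑-cong (λ y → ∑-cong (λ x → []-cong (y ≟ f x) (x ≟ g y) f⇒g g⇒f (λ _ → refl)) elements) elements ⟩
      ∑ (λ y → ∑ (λ x → [ x ≟ g y ] h y) elements) elements
        ≈⟨ ∑-cong (λ y → ∑-δ (λ _ → h y) (λ _ → refl) (g y)) elements ⟩
      ∑ h elements ∎

-- Reduction modulo the Jacobson radical

module _ (R : FiniteRing a ℓ) where
  open FiniteRing R

  ×-cong : ∀ n {x y} → x ≈ y → multiple +-rawMonoid n x ≈ multiple +-rawMonoid n y
  ×-cong zero    _   = refl
  ×-cong (suc n) x≈y = +-cong x≈y (×-cong n x≈y)

  •-cong : ∀ k {x y} → x ≈ y → _•_ R k x ≈ _•_ R k y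
  •-cong (ℤ.+ n)    x≈y = ×-cong n x≈y
  •-cong ℤ.-[1+ n ] x≈y = -‿cong (×-cong (suc n) x≈y)

  module _ {n} {x y : Vector Carrier n} (x≈y : ∀ i → x i ≈ y i) where

    evalWord-cong : ∀ w → evalWord R w x ≈ evalWord R w y
    evalWord-cong []      = refl
    evalWord-cong (i ∷ w) = *-cong (x≈y i) (evalWord-cong w)

    eval-cong : ∀ f → eval R f x ≈ eval R f y
    eval-cong []            = refl
    eval-cong ((k , w) ∷ f) = +-cong (•-cong k (evalWord-cong w)) (eval-cong f)

module _ (R : FiniteRing a ℓ) where
  private
    R/J = semisimplePart R
    module R/J = FiniteRing R/J
  open FiniteRing R
  open IsIdeal (isIdeal-J R)
  open AbelianGroupProperties +-abelianGroup using (x≈y⇒x∙y⁻¹≈ε; //-rightDividesˡ; //-rightDividesʳ)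

  ≈⇒≈J : ∀ {x y} → x ≈ y → x R/J.≈ y
  ≈⇒≈J x≈y = resp (sym (x≈y⇒x∙y⁻¹≈ε x≈y)) 0∈

  ×-semisimplePart : ∀ n x → multiple R/J.+-rawMonoid n x ≡ multiple +-rawMonoid n x
  ×-semisimplePart zero    x = ≡.refl
  ×-semisimplePart (suc n) x = ≡.cong (x +_) (×-semisimplePart n x)

  •-semisimplePart : ∀ k x → _•_ R/J k x ≡ _•_ R k x
  •-semisimplePart (ℤ.+ n)    x = ×-semisimplePart n x
  •-semisimplePart ℤ.-[1+ n ] x = ≡.cong -_ (×-semisimplePart (suc n) x)

  eval-semisimplePart : ∀ {n} (f : ℤ⟨X⟩ n) x → eval R/J f x ≡ eval R f x
  eval-semisimplePart []            x = ≡.refl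
  eval-semisimplePart ((k , w) ∷ f) x = ≡.cong₂ _+_
    (•-semisimplePart k (evalWord R w x)) (eval-semisimplePart f x)

  lift : ∀ {d} → Character R/J d → Character R d
  lift ψ = record
    { ⟦_⟧            = ⟦_⟧
    ; isHomomorphism = record
      { isMagmaHomomorphism = record
        { isRelHomomorphism = record { cong = λ x≈y → ⟦⟧-cong (λ i → ≈⇒≈J (x≈y i)) }
        ; homo = homo
        }
      ; ε-homo = ε-homo
      }
    }
    where
    open Character ψ
    open MonoidMorphisms.IsMonoidHomomorphism isHomomorphism

  module _ {c m} (M : CommutativeMonoid c m) where
    private
      module M = Sum M
      open M using (_∙_; ε; identityʳ; _×_; ×-congʳ; ×-assocˡ; ∑; [_]_; []-cong; ∑-cong; ∑-comm; ∑-×; ∑-cartesianProductWith; ∑-filter; ∑-[]-×; ∑-δ; ∑-bijection)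
      open ≈-Reasoning M.setoid

    ∑-coset : ∀ y z → ∑ (λ x → [ x R/J.≟ y ] z) elements M.≈ ∣J∣ R × z
    ∑-coset y z = begin
      ∑ (λ x → [ J? R (x - y) ] z) elements
        ≈⟨ ∑-bijection setoid isFinite (_- y) (_+ y)
             (λ {x} {w} w≈x-y → trans (sym (//-rightDividesˡ y x)) (+-congʳ (sym w≈x-y)))
             (λ {x} {w} x≈w+y → trans (sym (//-rightDividesʳ y w)) (+-congʳ (sym x≈w+y)))
             (λ x → [ J? R x ] z)
             (λ {x} {w} x≈w → []-cong (J? R x) (J? R w) (resp x≈w) (resp (sym x≈w)) (λ _ → M.refl)) ⟩
      ∑ (λ x → [ J? R x ] z) elements
        ≈⟨ ∑-[]-× (J? R) z elements ⟩
      ∣J∣ R × z ∎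

    ∑-semisimplePart : (h : Carrier → M.Carrier) → (∀ {x y} → x R/J.≈ y → h x M.≈ h y) →
                       ∑ h elements M.≈ ∣J∣ R × ∑ h R/J.elements
    ∑-semisimplePart h h-cong = begin
      ∑ h elements
        ≈⟨ ∑-cong (λ x → ∑-δ R/J.setoid R/J.isFinite h h-cong x) elements ⟨
      ∑ (λ x → ∑ (λ y → [ y R/J.≟ x ] h y) R/J.elements) elements
        ≈⟨ ∑-comm _ elements R/J.elements ⟩
      ∑ (λ y → ∑ (λ x → [ y R/J.≟ x ] h y) elements) R/J.elements
        ≈⟨ ∑-cong (λ y → ∑-cong (λ x → []-cong (y R/J.≟ x) (x R/J.≟ y) R/J.sym R/J.sym (λ _ → M.refl)) elements) R/J.elements ⟩
      ∑ (λ y → ∑ (λ x → [ x R/J.≟ y ] h y) elements) R/J.elements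
        ≈⟨ ∑-cong (λ y → ∑-coset y (h y)) R/J.elements ⟩
      ∑ (λ y → ∣J∣ R × h y) R/J.elements
        ≈⟨ ∑-× (∣J∣ R) h R/J.elements ⟩
      ∣J∣ R × ∑ h R/J.elements ∎

    ∑-graph : ∀ n (F F/J : Vector Carrier (suc n) → Carrier) →
      (∀ {u v} → (∀ i → Vector.init u i ≈ Vector.init v i) → F u ≈ F v) →
      (∀ {u v} → (∀ i → Vector.init u i R/J.≈ Vector.init v i) → F/J u R/J.≈ F/J v) →
      (∀ v → F v R/J.≈ F/J v) →
      (g : Vector Carrier (suc n) → M.Carrier) →
      (∀ {u v} → (∀ i → u i R/J.≈ v i) → g u M.≈ g v) →
      ∑ (λ v → [ Vector.last v ≟ F v ] g v) (points R (suc n)) M.≈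
      (∣J∣ R ℕ.^ n) × ∑ (λ v → [ Vector.last v R/J.≟ F/J v ] g v) (points R/J (suc n))
    ∑-graph zero F F/J F-cong F/J-cong F≈F/J g g-cong = begin
      ∑ (λ v → [ Vector.last v ≟ F v ] g v) (points R 1)
        ≈⟨ ∑-cartesianProductWith _ Vector._∷_ elements (points R 0) ⟩
      ∑ (λ x → ([ x ≟ F (x ∷[]) ] g (x ∷[])) ∙ ε) elements
        ≈⟨ ∑-cong (λ x → M.trans (identityʳ _) ([]-cong (x ≟ F (x ∷[])) (x ≟ t)
             (λ e → trans e (F-cong λ ())) (λ e → trans e (F-cong λ ())) (λ _ → M.refl))) elements ⟩
      ∑ (λ x → [ x ≟ t ] g (x ∷[])) elements
        ≈⟨ ∑-δ setoid isFinite (λ x → g (x ∷[])) (λ x≈y → g-∷[]-cong (≈⇒≈J x≈y)) t ⟩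
      g (t ∷[])
        ≈⟨ g-∷[]-cong (F≈F/J _) ⟩
      g (t/J ∷[])
        ≈⟨ ∑-δ R/J.setoid R/J.isFinite (λ x → g (x ∷[])) g-∷[]-cong t/J ⟨
      ∑ (λ x → [ x R/J.≟ t/J ] g (x ∷[])) R/J.elements
        ≈⟨ ∑-cong (λ x → M.trans (identityʳ _) ([]-cong (x R/J.≟ F/J (x ∷[])) (x R/J.≟ t/J)
             (λ e → R/J.trans e (F/J-cong λ ())) (λ e → R/J.trans e (F/J-cong λ ())) (λ _ → M.refl))) R/J.elements ⟨
      ∑ (λ x → ([ x R/J.≟ F/J (x ∷[]) ] g (x ∷[])) ∙ ε) R/J.elements
        ≈⟨ ∑-cartesianProductWith _ Vector._∷_ R/J.elements (points R/J 0) ⟨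
      ∑ (λ v → [ Vector.last v R/J.≟ F/J v ] g v) (points R/J 1)
        ≈⟨ identityʳ _ ⟨
      1 × ∑ (λ v → [ Vector.last v R/J.≟ F/J v ] g v) (points R/J 1) ∎
      where
      _∷[] : Carrier → Vector Carrier 1
      x ∷[] = x Vector.∷ Vector.[]
      t t/J : Carrier
      t   = F (0# ∷[])
      t/J = F/J (0# ∷[])
      g-∷[]-cong : ∀ {x y} → x R/J.≈ y → g (x ∷[]) M.≈ g (y ∷[])
      g-∷[]-cong x≈y = g-cong λ { zero → x≈y }
    ∑-graph (suc n) F F/J F-cong F/J-cong F≈F/J g g-cong = begin
      ∑ (λ v → [ Vector.last v ≟ F v ] g v) (points R (suc (suc n)))
        ≈⟨ ∑-cartesianProductWith _ Vector._∷_ elements (points R (suc n)) ⟩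
      ∑ (λ x → ∑ (λ v → [ Vector.last v ≟ F (x Vector.∷ v) ] g (x Vector.∷ v)) (points R (suc n))) elements
        ≈⟨ ∑-cong (λ x → ∑-graph n (λ v → F (x Vector.∷ v)) (λ v → F/J (x Vector.∷ v))
             (λ u≈v → F-cong λ { zero → refl ; (suc i) → u≈v i })
             (λ u≈v → F/J-cong λ { zero → R/J.refl ; (suc i) → u≈v i })
             (λ v → F≈F/J (x Vector.∷ v)) (λ v → g (x Vector.∷ v))
             (λ u≈v → g-cong λ { zero → R/J.refl ; (suc i) → u≈v i })) elements ⟩
      ∑ (λ x → N × h x) elements
        ≈⟨ ∑-× N h elements ⟩
      N × ∑ h elements
        ≈⟨ ×-congʳ N (∑-semisimplePart h h-cong) ⟩
      N × (∣J∣ R × ∑ h R/J.elements)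
        ≈⟨ ×-assocˡ _ N (∣J∣ R) ⟩
      (N ℕ.* ∣J∣ R) × ∑ h R/J.elements
        ≡⟨ ≡.cong (_× ∑ h R/J.elements) (ℕ.*-comm N (∣J∣ R)) ⟩
      (∣J∣ R ℕ.^ suc n) × ∑ h R/J.elements
        ≈⟨ ×-congʳ (∣J∣ R ℕ.^ suc n) (∑-cartesianProductWith _ Vector._∷_ R/J.elements (points R/J (suc n))) ⟨
      (∣J∣ R ℕ.^ suc n) × ∑ (λ v → [ Vector.last v R/J.≟ F/J v ] g v) (points R/J (suc (suc n))) ∎
      where
      N = ∣J∣ R ℕ.^ n
      h : Carrier → M.Carrier
      h x = ∑ (λ v → [ Vector.last v R/J.≟ F/J (x Vector.∷ v) ] g (x Vector.∷ v)) (points R/J (suc n))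
      h-cong : ∀ {x y} → x R/J.≈ y → h x M.≈ h y
      h-cong {x} {y} x≈y = ∑-cong (λ v → []-cong
        (Vector.last v R/J.≟ F/J (x Vector.∷ v)) (Vector.last v R/J.≟ F/J (y Vector.∷ v))
        (λ e → R/J.trans e (F/J-cong λ { zero → x≈y ; (suc _) → R/J.refl }))
        (λ e → R/J.trans e (F/J-cong λ { zero → R/J.sym x≈y ; (suc _) → R/J.refl }))
        (λ _ → g-cong λ { zero → x≈y ; (suc _) → R/J.refl })) (points R/J (suc n))

    ∑-V : ∀ {n} (f : ℤ⟨X⟩ n) k (g : Vector Carrier (suc n) → M.Carrier) →
          (∀ {u v} → (∀ i → u i R/J.≈ v i) → g u M.≈ g v) →
          ∑ g (members R (V? R f k)) M.≈ (∣J∣ R ℕ.^ n) × ∑ g (members R/J (V? R/J f k))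
    ∑-V {n} f k g g-cong = begin
      ∑ g (members R (V? R f k))
        ≈⟨ ∑-filter (V? R f k) g (points R (suc n)) ⟩
      ∑ (λ v → [ V? R f k v ] g v) (points R (suc n))
        ≈⟨ ∑-graph n (λ v → eval R f (Vector.init v) + _•_ R k 1#)
             (λ v → eval R/J f (Vector.init v) + _•_ R/J k 1#)
             (λ u≈v → +-congʳ (eval-cong R u≈v f))
             (λ {u} {v} u≈v → R/J.+-congʳ {_•_ R/J k 1#} {eval R/J f (Vector.init u)} {eval R/J f (Vector.init v)} (eval-cong R/J u≈v f))
             (λ v → R/J.sym (R/J.reflexive (≡.cong₂ _+_ (eval-semisimplePart f (Vector.init v)) (•-semisimplePart k 1#))))
             g g-cong ⟩
      (∣J∣ R ℕ.^ n) × ∑ (λ v → [ V? R/J f k v ] g v) (points R/J (suc n))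
        ≈⟨ ×-congʳ (∣J∣ R ℕ.^ n) (∑-filter (V? R/J f k) g (points R/J (suc n))) ⟨
      (∣J∣ R ℕ.^ n) × ∑ g (members R/J (V? R/J f k)) ∎

-- Real and complex numbers

-- Two reals or complex numbers that differ syntactically are compared by unfolding
-- √ and the Cauchy proofs, which is hopeless.  Hence the implicit arguments given
-- explicitly, the abstract blocks and the rewriting along equations proved by refl.

module RealProperties where

  ℚ-ring : AlmostCommutativeRing 0ℓ 0ℓ
  ℚ-ring = fromCommutativeRing ℚ.+-*-commutativeRing (λ q → dec⇒maybe (0ℚ ℚ.≟ q))

  module _ where
    open ℚ.≤-Reasoning

    -p≤∣p∣ : ∀ p → ℚ.- p ℚ.≤ ℚ.∣ p ∣
    -p≤∣p∣ p with ℚ.≤-total 0ℚ p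
    ... | inj₁ 0≤p = ℚ.≤-trans (ℚ.neg-antimono-≤ 0≤p) (ℚ.0≤∣p∣ p)
    ... | inj₂ p≤0 = begin
      ℚ.- p         ≡⟨ ℚ.0≤p⇒∣p∣≡p (ℚ.neg-antimono-≤ p≤0) ⟨
      ℚ.∣ ℚ.- p ∣   ≡⟨ ℚ.∣-p∣≡∣p∣ p ⟩
      ℚ.∣ p ∣       ∎

    -[-p]≡p : ∀ p → ℚ.- (ℚ.- p) ≡ p
    -[-p]≡p = solve-∀ ℚ-ring

    p≤∣p∣ : ∀ p → p ℚ.≤ ℚ.∣ p ∣
    p≤∣p∣ p = begin
      p               ≡⟨ -[-p]≡p p ⟨
      ℚ.- (ℚ.- p)     ≤⟨ -p≤∣p∣ (ℚ.- p) ⟩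
      ℚ.∣ ℚ.- p ∣     ≡⟨ ℚ.∣-p∣≡∣p∣ p ⟩
      ℚ.∣ p ∣         ∎

    x≡y+[x-y] : ∀ x y → x ≡ y ℚ.+ (x ℚ.- y)
    x≡y+[x-y] = solve-∀ ℚ-ring

    y≡x-[x-y] : ∀ x y → y ≡ x ℚ.+ ℚ.- (x ℚ.- y)
    y≡x-[x-y] = solve-∀ ℚ-ring

    y+ε-y≡ε : ∀ y ε → (y ℚ.+ ε) ℚ.- y ≡ ε
    y+ε-y≡ε = solve-∀ ℚ-ring

    -[x-y]≡y-x : ∀ x y → ℚ.- (x ℚ.- y) ≡ y ℚ.- x
    -[x-y]≡y-x = solve-∀ ℚ-ring

    ∣x-y∣≤ε⇒x≤y+ε : ∀ x y {ε} → ℚ.∣ x ℚ.- y ∣ ℚ.≤ ε → x ℚ.≤ y ℚ.+ ε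
    ∣x-y∣≤ε⇒x≤y+ε x y {ε} h = begin
      x                     ≡⟨ x≡y+[x-y] x y ⟩
      y ℚ.+ (x ℚ.- y)       ≤⟨ ℚ.+-monoʳ-≤ y (ℚ.≤-trans (p≤∣p∣ _) h) ⟩
      y ℚ.+ ε               ∎

    ∣x-y∣≤ε⇒y≤x+ε : ∀ x y {ε} → ℚ.∣ x ℚ.- y ∣ ℚ.≤ ε → y ℚ.≤ x ℚ.+ ε
    ∣x-y∣≤ε⇒y≤x+ε x y {ε} h = begin
      y                           ≡⟨ y≡x-[x-y] x y ⟩
      x ℚ.+ ℚ.- (x ℚ.- y)         ≤⟨ ℚ.+-monoʳ-≤ x (ℚ.≤-trans (-p≤∣p∣ _) h) ⟩
      x ℚ.+ ε                     ∎

    x≤y+ε⇒x-y≤ε : ∀ x y {ε} → x ℚ.≤ y ℚ.+ ε → x ℚ.- y ℚ.≤ ε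
    x≤y+ε⇒x-y≤ε x y {ε} h = ℚ.≤-trans (ℚ.+-monoˡ-≤ (ℚ.- y) h) (ℚ.≤-reflexive (y+ε-y≡ε y ε))

    ∣x-y∣≤ε : ∀ x y {ε} → x ℚ.≤ y ℚ.+ ε → y ℚ.≤ x ℚ.+ ε → ℚ.∣ x ℚ.- y ∣ ℚ.≤ ε
    ∣x-y∣≤ε x y h k with ℚ.∣p∣≡p∨∣p∣≡-p (x ℚ.- y)
    ... | inj₁ eq = ℚ.≤-trans (ℚ.≤-reflexive eq) (x≤y+ε⇒x-y≤ε x y h)
    ... | inj₂ eq = ℚ.≤-trans (ℚ.≤-reflexive (≡.trans eq (-[x-y]≡y-x x y))) (x≤y+ε⇒x-y≤ε y x k)

    *-mono-nonNeg : ∀ {p q r s} → 0ℚ ℚ.≤ p → 0ℚ ℚ.≤ s → p ℚ.≤ q → r ℚ.≤ s → p ℚ.* r ℚ.≤ q ℚ.* s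
    *-mono-nonNeg {p} {q} {r} {s} 0≤p 0≤s p≤q r≤s = ℚ.≤-trans
      (ℚ.*-monoˡ-≤-nonNeg p {{ℚ.nonNegative 0≤p}} r≤s)
      (ℚ.*-monoʳ-≤-nonNeg s {{ℚ.nonNegative 0≤s}} p≤q)

    *-nonNeg : ∀ {p q} → 0ℚ ℚ.≤ p → 0ℚ ℚ.≤ q → 0ℚ ℚ.≤ p ℚ.* q
    *-nonNeg {p} {q} 0≤p 0≤q = ℚ.nonNegative⁻¹ (p ℚ.* q)
      {{ℚ.nonNeg*nonNeg⇒nonNeg p {{ℚ.nonNegative 0≤p}} q {{ℚ.nonNegative 0≤q}}}}

    *-pos : ∀ {p q} → 0ℚ ℚ.< p → 0ℚ ℚ.< q → 0ℚ ℚ.< p ℚ.* q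
    *-pos {p} {q} 0<p 0<q = ℚ.positive⁻¹ (p ℚ.* q)
      {{ℚ.pos*pos⇒pos p {{ℚ.positive 0<p}} q {{ℚ.positive 0<q}}}}

    square-nonNeg : ∀ p → 0ℚ ℚ.≤ p ℚ.* p
    square-nonNeg p with ℚ.≤-total 0ℚ p
    ... | inj₁ 0≤p = *-nonNeg 0≤p 0≤p
    ... | inj₂ p≤0 = ℚ.nonNegative⁻¹ (p ℚ.* p)
      {{ℚ.nonPos*nonPos⇒nonPos p {{ℚ.nonPositive p≤0}} p {{ℚ.nonPositive p≤0}}}}

    square-cancel-≤ : ∀ {p q} → 0ℚ ℚ.≤ q → p ℚ.* p ℚ.≤ q ℚ.* q → p ℚ.≤ q
    square-cancel-≤ {p} {q} 0≤q p²≤q² with p ℚ.≤? q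
    ... | yes p≤q = p≤q
    ... | no  p≰q = ⊥-elim (ℚ.<-irrefl {p ℚ.* p} ≡.refl (begin-strict
      p ℚ.* p   ≤⟨ p²≤q² ⟩
      q ℚ.* q   ≤⟨ ℚ.*-monoˡ-≤-nonNeg q {{ℚ.nonNegative 0≤q}} (ℚ.<⇒≤ q<p) ⟩
      q ℚ.* p   <⟨ ℚ.*-monoˡ-<-pos p {{ℚ.positive (ℚ.≤-<-trans 0≤q q<p)}} q<p ⟩
      p ℚ.* p   ∎))
      where q<p = ℚ.≰⇒> p≰q

    p≤p+nonNeg : ∀ {p q} → 0ℚ ℚ.≤ q → p ℚ.≤ p ℚ.+ q
    p≤p+nonNeg {p} 0≤q = ℚ.≤-trans (ℚ.≤-reflexive (≡.sym (ℚ.+-identityʳ p))) (ℚ.+-monoʳ-≤ p 0≤q)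

    square-+ : ∀ p q → (p ℚ.+ q) ℚ.* (p ℚ.+ q) ≡ (p ℚ.* p ℚ.+ q ℚ.* q) ℚ.+ (p ℚ.* q ℚ.+ p ℚ.* q)
    square-+ = solve-∀ ℚ-ring

    p²+q²≤[p+q]² : ∀ {p q} → 0ℚ ℚ.≤ p → 0ℚ ℚ.≤ q → p ℚ.* p ℚ.+ q ℚ.* q ℚ.≤ (p ℚ.+ q) ℚ.* (p ℚ.+ q)
    p²+q²≤[p+q]² {p} {q} 0≤p 0≤q = begin
      p ℚ.* p ℚ.+ q ℚ.* q                                  ≤⟨ p≤p+nonNeg (ℚ.+-mono-≤ (*-nonNeg 0≤p 0≤q) (*-nonNeg 0≤p 0≤q)) ⟩
      (p ℚ.* p ℚ.+ q ℚ.* q) ℚ.+ (p ℚ.* q ℚ.+ p ℚ.* q)      ≡⟨ square-+ p q ⟨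
      (p ℚ.+ q) ℚ.* (p ℚ.+ q)                              ∎

    ½-pos : ∀ {ε} → 0ℚ ℚ.< ε → 0ℚ ℚ.< ½ ℚ.* ε
    ½-pos = *-pos (ℚ.positive⁻¹ ½)

    ½+½ : ∀ ε → ½ ℚ.* ε ℚ.+ ½ ℚ.* ε ≡ ε
    ½+½ ε = ≡.trans (≡.sym (ℚ.*-distribʳ-+ ε ½ ½)) (ℚ.*-identityˡ ε)

    abstract
      divide : ∀ {ε} B → 0ℚ ℚ.< ε → 0ℚ ℚ.< B → ∃ λ δ → (0ℚ ℚ.< δ) Product.× (δ ℚ.* B ≡ ε)
      divide {ε} B 0<ε 0<B =
        ε ℚ.* ℚ.1/ B , *-pos 0<ε (ℚ.positive⁻¹ (ℚ.1/ B) {{ℚ.1/pos⇒pos B}}) ,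
        ≡.trans (ℚ.*-assoc ε (ℚ.1/ B) B) (≡.trans (≡.cong (ε ℚ.*_) (ℚ.*-inverseˡ B)) (ℚ.*-identityʳ ε))
        where instance
          B>0 : ℚ.Positive B
          B>0 = ℚ.positive 0<B
          B≢0 : ℚ.NonZero B
          B≢0 = ℚ.pos⇒nonZero B

  toℚᵘ-/ : ∀ i n → ℚ.toℚᵘ (i ℚ./ suc n) ℚᵘ.≃ ℚᵘ.mkℚᵘ i n
  toℚᵘ-/ i n = ℚ.toℚᵘ-fromℚᵘ (ℚᵘ.mkℚᵘ i n)

  abstract
    archimedean : ∀ ε → 0ℚ ℚ.< ε → ∃ λ N → ∀ n → N ℕ.≤ n → 1ℤ ℚ./ suc n ℚ.≤ ε
    archimedean (mkℚ (ℤ.+ zero) _ _) (*<* (ℤ.+<+ ()))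
    archimedean (mkℚ ℤ.-[1+ _ ] _ _) (*<* ())
    archimedean (mkℚ (ℤ.+ suc a) d-1 _) _ = suc d-1 , λ n N≤n → ℚ.toℚᵘ-cancel-≤
      (ℚᵘ.≤-respˡ-≃ (ℚᵘ.≃-sym (toℚᵘ-/ 1ℤ n)) (ℚᵘ.*≤* (ℤ.+≤+ (begin
        1 ℕ.* suc d-1      ≡⟨ ℕ.*-identityˡ (suc d-1) ⟩
        suc d-1            ≤⟨ N≤n ⟩
        n                  ≤⟨ ℕ.n≤1+n n ⟩
        suc n              ≤⟨ ℕ.m≤n*m (suc n) (suc a) ⟩
        suc a ℕ.* suc n    ∎))))
      where open ℕ.≤-Reasoning

  suc/1 : ∀ n → ℤ.+ suc n ℚ./ 1 ≡ 1ℚ ℚ.+ (ℤ.+ n ℚ./ 1)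
  suc/1 n = ℚ.toℚᵘ-injective (begin-equality
    ℚ.toℚᵘ (ℤ.+ suc n ℚ./ 1)                 ≃⟨ toℚᵘ-/ (ℤ.+ suc n) 0 ⟩
    ℚᵘ.mkℚᵘ (ℤ.+ suc n) 0                    ≃⟨ ℚᵘ.*≡* (≡.cong (λ k → (1ℤ ℤ.+ k) ℤ.* 1ℤ) (≡.sym (ℤ.*-identityʳ (ℤ.+ n)))) ⟩
    ℚᵘ.1ℚᵘ ℚᵘ.+ ℚᵘ.mkℚᵘ (ℤ.+ n) 0            ≃⟨ ℚᵘ.+-congʳ ℚᵘ.1ℚᵘ (toℚᵘ-/ (ℤ.+ n) 0) ⟨
    ℚ.toℚᵘ 1ℚ ℚᵘ.+ ℚ.toℚᵘ (ℤ.+ n ℚ./ 1)      ≃⟨ ℚ.toℚᵘ-homo-+ 1ℚ (ℤ.+ n ℚ./ 1) ⟨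
    ℚ.toℚᵘ (1ℚ ℚ.+ (ℤ.+ n ℚ./ 1))            ∎)
    where open ℚᵘ.≤-Reasoning

  */1 : ∀ m n → ℤ.+ (m ℕ.* n) ℚ./ 1 ≡ (ℤ.+ m ℚ./ 1) ℚ.* (ℤ.+ n ℚ./ 1)
  */1 m n = ℚ.toℚᵘ-injective (begin-equality
    ℚ.toℚᵘ (ℤ.+ (m ℕ.* n) ℚ./ 1)                       ≃⟨ toℚᵘ-/ (ℤ.+ (m ℕ.* n)) 0 ⟩
    ℚᵘ.mkℚᵘ (ℤ.+ (m ℕ.* n)) 0                          ≃⟨ ℚᵘ.*≡* (≡.cong (ℤ._* 1ℤ) (ℤ.pos-* m n)) ⟩
    ℚᵘ.mkℚᵘ (ℤ.+ m) 0 ℚᵘ.* ℚᵘ.mkℚᵘ (ℤ.+ n) 0           ≃⟨ ℚᵘ.*-cong (toℚᵘ-/ (ℤ.+ m) 0) (toℚᵘ-/ (ℤ.+ n) 0) ⟨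
    ℚ.toℚᵘ (ℤ.+ m ℚ./ 1) ℚᵘ.* ℚ.toℚᵘ (ℤ.+ n ℚ./ 1)     ≃⟨ ℚ.toℚᵘ-homo-* (ℤ.+ m ℚ./ 1) (ℤ.+ n ℚ./ 1) ⟨
    ℚ.toℚᵘ ((ℤ.+ m ℚ./ 1) ℚ.* (ℤ.+ n ℚ./ 1))           ∎)
    where open ℚᵘ.≤-Reasoning

  NonNeg : ℝ → Set
  NonNeg x = ∀ n → 0ℚ ℚ.≤ seq x n

  private
    variable
      x y z u v : ℝ

  ≗⇒≤ : (∀ n → seq x n ≡ seq y n) → x ≤ℝ y
  ≗⇒≤ x≗y ε 0<ε = 0 , λ n _ → ℚ.≤-trans (ℚ.≤-reflexive (x≗y n)) (p≤p+nonNeg (ℚ.<⇒≤ 0<ε))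

  ≤-trans : x ≤ℝ y → y ≤ℝ z → x ≤ℝ z
  ≤-trans {x} {y} {z} x≤y y≤z ε 0<ε =
    let M , h = x≤y (½ ℚ.* ε) (½-pos 0<ε)
        N , k = y≤z (½ ℚ.* ε) (½-pos 0<ε)
    in M ℕ.⊔ N , λ n M⊔N≤n → begin
      seq x n                                     ≤⟨ h n (ℕ.m⊔n≤o⇒m≤o M N M⊔N≤n) ⟩
      seq y n ℚ.+ ½ ℚ.* ε                         ≤⟨ ℚ.+-monoˡ-≤ (½ ℚ.* ε) (k n (ℕ.m⊔n≤o⇒n≤o M N M⊔N≤n)) ⟩
      (seq z n ℚ.+ ½ ℚ.* ε) ℚ.+ ½ ℚ.* ε           ≡⟨ ℚ.+-assoc (seq z n) _ _ ⟩
      seq z n ℚ.+ (½ ℚ.* ε ℚ.+ ½ ℚ.* ε)           ≡⟨ ≡.cong (seq z n ℚ.+_) (½+½ ε) ⟩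
      seq z n ℚ.+ ε                               ∎
    where open ℚ.≤-Reasoning

  ≈⇒≤ : x ≈ℝ y → x ≤ℝ y
  ≈⇒≤ {x} {y} x≈y ε 0<ε = let N , h = x≈y ε 0<ε in N , λ n N≤n → ∣x-y∣≤ε⇒x≤y+ε (seq x n) (seq y n) (h n N≤n)

  ≈⇒≥ : x ≈ℝ y → x ≥ℝ y
  ≈⇒≥ {x} {y} x≈y ε 0<ε = let N , h = x≈y ε 0<ε in N , λ n N≤n → ∣x-y∣≤ε⇒y≤x+ε (seq x n) (seq y n) (h n N≤n)

  ≤-antisym : x ≤ℝ y → y ≤ℝ x → x ≈ℝ y
  ≤-antisym {x} {y} x≤y y≤x ε 0<ε =
    let M , h = x≤y ε 0<ε
        N , k = y≤x ε 0<ε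
    in M ℕ.⊔ N , λ n M⊔N≤n → ∣x-y∣≤ε (seq x n) (seq y n) (h n (ℕ.m⊔n≤o⇒m≤o M N M⊔N≤n)) (k n (ℕ.m⊔n≤o⇒n≤o M N M⊔N≤n))

  ≗⇒≈ : (∀ n → seq x n ≡ seq y n) → x ≈ℝ y
  ≗⇒≈ {x} {y} x≗y = ≤-antisym {x} {y} (≗⇒≤ {x} {y} x≗y) (≗⇒≤ {y} {x} λ n → ≡.sym (x≗y n))

  ≈-refl : x ≈ℝ x
  ≈-refl {x} = ≗⇒≈ {x} {x} λ _ → ≡.refl

  ≈-sym : x ≈ℝ y → y ≈ℝ x
  ≈-sym {x} {y} x≈y = ≤-antisym {y} {x} (≈⇒≥ {x} {y} x≈y) (≈⇒≤ {x} {y} x≈y)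

  ≈-trans : x ≈ℝ y → y ≈ℝ z → x ≈ℝ z
  ≈-trans {x} {y} {z} x≈y y≈z = ≤-antisym {x} {z}
    (≤-trans {x} {y} {z} (≈⇒≤ {x} {y} x≈y) (≈⇒≤ {y} {z} y≈z))
    (≤-trans {z} {y} {x} (≈⇒≥ {y} {z} y≈z) (≈⇒≥ {x} {y} x≈y))

  ≤-preorder : Preorder 0ℓ 0ℓ 0ℓ
  ≤-preorder = record
    { Carrier    = ℝ
    ; _≈_        = _≈ℝ_
    ; _≲_        = _≤ℝ_
    ; isPreorder = record
      { isEquivalence = record
        { refl  = λ {x} → ≈-refl {x}
        ; sym   = λ {x} {y} → ≈-sym {x} {y}
        ; trans = λ {x} {y} {z} → ≈-trans {x} {y} {z}
        }
      ; reflexive = λ {x} {y} → ≈⇒≤ {x} {y}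
      ; trans     = λ {x} {y} {z} → ≤-trans {x} {y} {z}
      }
    }

  +-exchange : ∀ p q r s → (p ℚ.+ r) ℚ.+ (q ℚ.+ s) ≡ (p ℚ.+ q) ℚ.+ (r ℚ.+ s)
  +-exchange = solve-∀ ℚ-ring

  +-mono-≤ : x ≤ℝ y → u ≤ℝ v → x +ℝ u ≤ℝ y +ℝ v
  +-mono-≤ {x} {y} {u} {v} x≤y u≤v ε 0<ε =
    let M , h = x≤y (½ ℚ.* ε) (½-pos 0<ε)
        N , k = u≤v (½ ℚ.* ε) (½-pos 0<ε)
    in M ℕ.⊔ N , λ n M⊔N≤n → begin
      seq x n ℚ.+ seq u n                                     ≤⟨ ℚ.+-mono-≤ (h n (ℕ.m⊔n≤o⇒m≤o M N M⊔N≤n)) (k n (ℕ.m⊔n≤o⇒n≤o M N M⊔N≤n)) ⟩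
      (seq y n ℚ.+ ½ ℚ.* ε) ℚ.+ (seq v n ℚ.+ ½ ℚ.* ε)         ≡⟨ +-exchange (seq y n) (seq v n) _ _ ⟩
      (seq y n ℚ.+ seq v n) ℚ.+ (½ ℚ.* ε ℚ.+ ½ ℚ.* ε)         ≡⟨ ≡.cong ((seq y n ℚ.+ seq v n) ℚ.+_) (½+½ ε) ⟩
      (seq y n ℚ.+ seq v n) ℚ.+ ε                             ∎
    where open ℚ.≤-Reasoning

  +-cong : x ≈ℝ y → u ≈ℝ v → x +ℝ u ≈ℝ y +ℝ v
  +-cong {x} {y} {u} {v} x≈y u≈v = ≤-antisym {x +ℝ u} {y +ℝ v}
    (+-mono-≤ {x} {y} {u} {v} (≈⇒≤ {x} {y} x≈y) (≈⇒≤ {u} {v} u≈v))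
    (+-mono-≤ {y} {x} {v} {u} (≈⇒≥ {x} {y} x≈y) (≈⇒≥ {u} {v} u≈v))

  abstract
    bounded : ∀ x → ∃ λ B → (0ℚ ℚ.< B) Product.× ∃ λ N → ∀ n → N ℕ.≤ n → ℚ.∣ seq x n ∣ ℚ.≤ B
    bounded x with N , h ← cauchy x 1ℚ (ℚ.positive⁻¹ 1ℚ) =
      ℚ.∣ seq x N ∣ ℚ.+ 1ℚ ,
      ℚ.+-mono-≤-< (ℚ.0≤∣p∣ (seq x N)) (ℚ.positive⁻¹ 1ℚ) ,
      N , λ n N≤n → begin
        ℚ.∣ seq x n ∣                                     ≡⟨ ≡.cong ℚ.∣_∣ (x≡y+[x-y] (seq x n) (seq x N)) ⟩
        ℚ.∣ seq x N ℚ.+ (seq x n ℚ.- seq x N) ∣           ≤⟨ ℚ.∣p+q∣≤∣p∣+∣q∣ (seq x N) _ ⟩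
        ℚ.∣ seq x N ∣ ℚ.+ ℚ.∣ seq x n ℚ.- seq x N ∣       ≤⟨ ℚ.+-monoʳ-≤ ℚ.∣ seq x N ∣ (h n N N≤n ℕ.≤-refl) ⟩
        ℚ.∣ seq x N ∣ ℚ.+ 1ℚ                              ∎
      where open ℚ.≤-Reasoning

  *-monoˡ-≤ : ∀ z → NonNeg z → x ≤ℝ y → x *ℝ z ≤ℝ y *ℝ z
  *-monoˡ-≤ {x} {y} z 0≤z x≤y ε 0<ε =
    let B , 0<B , M , b = bounded z
        δ , 0<δ , δB≡ε  = divide B 0<ε 0<B
        N , h           = x≤y δ 0<δ
    in M ℕ.⊔ N , λ n M⊔N≤n → begin
      seq x n ℚ.* seq z n                           ≤⟨ ℚ.*-monoʳ-≤-nonNeg (seq z n) {{ℚ.nonNegative (0≤z n)}} (h n (ℕ.m⊔n≤o⇒n≤o M N M⊔N≤n)) ⟩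
      (seq y n ℚ.+ δ) ℚ.* seq z n                   ≡⟨ ℚ.*-distribʳ-+ (seq z n) (seq y n) δ ⟩
      seq y n ℚ.* seq z n ℚ.+ δ ℚ.* seq z n         ≤⟨ ℚ.+-monoʳ-≤ (seq y n ℚ.* seq z n) (ℚ.*-monoˡ-≤-nonNeg δ {{ℚ.nonNegative (ℚ.<⇒≤ 0<δ)}}
                                                         (ℚ.≤-trans (p≤∣p∣ (seq z n)) (b n (ℕ.m⊔n≤o⇒m≤o M N M⊔N≤n)))) ⟩
      seq y n ℚ.* seq z n ℚ.+ δ ℚ.* B               ≡⟨ ≡.cong (seq y n ℚ.* seq z n ℚ.+_) δB≡ε ⟩
      seq y n ℚ.* seq z n ℚ.+ ε                     ∎
    where open ℚ.≤-Reasoning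

  [x-y]z : ∀ x y z → x ℚ.* z ℚ.- y ℚ.* z ≡ (x ℚ.- y) ℚ.* z
  [x-y]z = solve-∀ ℚ-ring

  *-congʳ : ∀ z → x ≈ℝ y → x *ℝ z ≈ℝ y *ℝ z
  *-congʳ {x} {y} z x≈y ε 0<ε =
    let B , 0<B , M , b = bounded z
        δ , 0<δ , δB≡ε  = divide B 0<ε 0<B
        N , h           = x≈y δ 0<δ
    in M ℕ.⊔ N , λ n M⊔N≤n → begin
      ℚ.∣ seq x n ℚ.* seq z n ℚ.- seq y n ℚ.* seq z n ∣     ≡⟨ ≡.cong ℚ.∣_∣ ([x-y]z (seq x n) (seq y n) (seq z n)) ⟩
      ℚ.∣ (seq x n ℚ.- seq y n) ℚ.* seq z n ∣               ≡⟨ ℚ.∣p*q∣≡∣p∣*∣q∣ (seq x n ℚ.- seq y n) (seq z n) ⟩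
      ℚ.∣ seq x n ℚ.- seq y n ∣ ℚ.* ℚ.∣ seq z n ∣           ≤⟨ *-mono-nonNeg (ℚ.0≤∣p∣ _) (ℚ.<⇒≤ 0<B)
                                                                 (h n (ℕ.m⊔n≤o⇒n≤o M N M⊔N≤n)) (b n (ℕ.m⊔n≤o⇒m≤o M N M⊔N≤n)) ⟩
      δ ℚ.* B                                               ≡⟨ δB≡ε ⟩
      ε                                                     ∎
    where open ℚ.≤-Reasoning

  *-comm : ∀ x y → x *ℝ y ≈ℝ y *ℝ x
  *-comm x y = ≗⇒≈ {x *ℝ y} {y *ℝ x} λ n → ℚ.*-comm (seq x n) (seq y n)

  *-congˡ : ∀ z → x ≈ℝ y → z *ℝ x ≈ℝ z *ℝ y
  *-congˡ {x} {y} z x≈y = ≈-trans {z *ℝ x} {x *ℝ z} {z *ℝ y} (*-comm z x)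
    (≈-trans {x *ℝ z} {y *ℝ z} {z *ℝ y} (*-congʳ {x} {y} z x≈y) (*-comm y z))

  *-cong : x ≈ℝ y → u ≈ℝ v → x *ℝ u ≈ℝ y *ℝ v
  *-cong {x} {y} {u} {v} x≈y u≈v = ≈-trans {x *ℝ u} {y *ℝ u} {y *ℝ v}
    (*-congʳ {x} {y} u x≈y) (*-congˡ {u} {v} y u≈v)

  √-nonNeg : ∀ x → NonNeg (√ x)
  √-nonNeg x n = √-approx-nonNeg n (seq x n)

  1/-nonNeg : ∀ n → 0ℚ ℚ.≤ 1ℤ ℚ./ suc n
  1/-nonNeg n = ℚ.nonNegative⁻¹ (1ℤ ℚ./ suc n) {{ℚ.normalize-nonNeg 1 (suc n)}}

  square-+′ : ∀ s t → (s ℚ.+ t) ℚ.* (s ℚ.+ t) ≡ s ℚ.* s ℚ.+ t ℚ.* (s ℚ.+ s ℚ.+ t)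
  square-+′ = solve-∀ ℚ-ring

  -- s stands for √-approx n q.
  module _ {s q : ℚ} where
    open ℚ.≤-Reasoning

    lower-≤ : s ≡ 0ℚ ⊎ s ℚ.* s ℚ.≤ q → ∀ {t ε} → 0ℚ ℚ.≤ t → 0ℚ ℚ.≤ ε → q ℚ.≤ t ℚ.* t ℚ.+ ε ℚ.* ε → s ℚ.≤ t ℚ.+ ε
    lower-≤ (inj₁ s≡0)  0≤t 0≤ε _ = ℚ.≤-trans (ℚ.≤-reflexive s≡0) (ℚ.+-mono-≤ 0≤t 0≤ε)
    lower-≤ (inj₂ s²≤q) 0≤t 0≤ε h = square-cancel-≤ (ℚ.+-mono-≤ 0≤t 0≤ε)
      (ℚ.≤-trans s²≤q (ℚ.≤-trans h (p²+q²≤[p+q]² 0≤t 0≤ε)))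

    lower-square : s ≡ 0ℚ ⊎ s ℚ.* s ℚ.≤ q → 0ℚ ℚ.≤ q → s ℚ.* s ℚ.≤ q
    lower-square (inj₁ s≡0)  0≤q = ℚ.≤-trans (ℚ.≤-reflexive (≡.cong (λ s → s ℚ.* s) s≡0)) 0≤q
    lower-square (inj₂ s²≤q) _   = s²≤q

    module _ {v δ : ℚ} (0≤s : 0ℚ ℚ.≤ s) (0≤v : 0ℚ ℚ.≤ v) (v≤δ : v ℚ.≤ δ) (q< : q ℚ.< (s ℚ.+ v) ℚ.* (s ℚ.+ v)) where

      upper-≤ : ∀ {t} → t ℚ.* t ℚ.≤ q ℚ.+ δ ℚ.* δ → t ℚ.≤ s ℚ.+ (δ ℚ.+ δ)
      upper-≤ {t} h = begin
        t                        ≤⟨ square-cancel-≤ (ℚ.+-mono-≤ 0≤s+v 0≤δ) (begin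
          t ℚ.* t                                      ≤⟨ h ⟩
          q ℚ.+ δ ℚ.* δ                                ≤⟨ ℚ.+-monoˡ-≤ (δ ℚ.* δ) (ℚ.<⇒≤ q<) ⟩
          (s ℚ.+ v) ℚ.* (s ℚ.+ v) ℚ.+ δ ℚ.* δ          ≤⟨ p²+q²≤[p+q]² 0≤s+v 0≤δ ⟩
          (s ℚ.+ v ℚ.+ δ) ℚ.* (s ℚ.+ v ℚ.+ δ)          ∎) ⟩
        (s ℚ.+ v) ℚ.+ δ          ≤⟨ ℚ.+-monoˡ-≤ δ (ℚ.+-monoʳ-≤ s v≤δ) ⟩
        (s ℚ.+ δ) ℚ.+ δ          ≡⟨ ℚ.+-assoc s δ δ ⟩
        s ℚ.+ (δ ℚ.+ δ)          ∎
        where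
        0≤s+v : 0ℚ ℚ.≤ s ℚ.+ v
        0≤s+v = ℚ.+-mono-≤ 0≤s 0≤v
        0≤δ : 0ℚ ℚ.≤ δ
        0≤δ = ℚ.≤-trans 0≤v v≤δ

      upper-square : ∀ {B} → 0ℚ ℚ.≤ B → s ℚ.≤ B → v ℚ.≤ 1ℚ → q ℚ.≤ s ℚ.* s ℚ.+ δ ℚ.* (B ℚ.+ B ℚ.+ 1ℚ)
      upper-square {B} 0≤B s≤B v≤1 = begin
        q                                         ≤⟨ ℚ.<⇒≤ q< ⟩
        (s ℚ.+ v) ℚ.* (s ℚ.+ v)                   ≡⟨ square-+′ s v ⟩
        s ℚ.* s ℚ.+ v ℚ.* (s ℚ.+ s ℚ.+ v)         ≤⟨ ℚ.+-monoʳ-≤ (s ℚ.* s) (*-mono-nonNeg 0≤v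
                                                       (ℚ.+-mono-≤ (ℚ.+-mono-≤ 0≤B 0≤B) (ℚ.nonNegative⁻¹ 1ℚ))
                                                       v≤δ (ℚ.+-mono-≤ (ℚ.+-mono-≤ s≤B s≤B) v≤1)) ⟩
        s ℚ.* s ℚ.+ δ ℚ.* (B ℚ.+ B ℚ.+ 1ℚ)        ∎

  √-unique : NonNeg y → y *ℝ y ≈ℝ x → √ x ≈ℝ y
  √-unique {y} {x} 0≤y y²≈x = ≤-antisym {√ x} {y} √x≤y y≤√x
    where
    √x≤y : √ x ≤ℝ y
    √x≤y ε 0<ε =
      let N , h = y²≈x (ε ℚ.* ε) (*-pos 0<ε 0<ε)
      in N , λ n N≤n → lower-≤ {seq (√ x) n} {seq x n} (√-approx-lower n (seq x n))
        (0≤y n) (ℚ.<⇒≤ 0<ε) (∣x-y∣≤ε⇒y≤x+ε (seq y n ℚ.* seq y n) (seq x n) (h n N≤n))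

    y≤√x : y ≤ℝ √ x
    y≤√x ε 0<ε =
      let δ     = ½ ℚ.* ε
          0<δ   = ½-pos 0<ε
          M , h = y²≈x (δ ℚ.* δ) (*-pos 0<δ 0<δ)
          N , k = archimedean δ 0<δ
      in M ℕ.⊔ N , λ n M⊔N≤n → ≡.subst (λ e → seq y n ℚ.≤ seq (√ x) n ℚ.+ e) (½+½ ε)
        (upper-≤ {seq (√ x) n} {seq x n} {1ℤ ℚ./ suc n} {δ} (√-nonNeg x n) (1/-nonNeg n)
          (k n (ℕ.m⊔n≤o⇒n≤o M N M⊔N≤n)) (√-approx-upper n (seq x n)) {seq y n}
          (∣x-y∣≤ε⇒x≤y+ε (seq y n ℚ.* seq y n) (seq x n) (h n (ℕ.m⊔n≤o⇒m≤o M N M⊔N≤n))))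

  √-square : NonNeg x → √ x *ℝ √ x ≈ℝ x
  √-square {x} 0≤x = ≤-antisym {√ x *ℝ √ x} {x} √x²≤x x≤√x²
    where
    √x²≤x : √ x *ℝ √ x ≤ℝ x
    √x²≤x ε 0<ε = 0 , λ n _ → ℚ.≤-trans
      (lower-square {seq (√ x) n} {seq x n} (√-approx-lower n (seq x n)) (0≤x n))
      (p≤p+nonNeg (ℚ.<⇒≤ 0<ε))

    x≤√x² : x ≤ℝ √ x *ℝ √ x
    x≤√x² ε 0<ε =
      let B , 0<B , K , b      = bounded (√ x)
          δ , 0<δ , δ[B+B+1]≡ε = divide (B ℚ.+ B ℚ.+ 1ℚ) 0<ε (ℚ.+-mono-< (ℚ.+-mono-< 0<B 0<B) (ℚ.positive⁻¹ 1ℚ))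
          L , v≤δ              = archimedean δ 0<δ
          L′ , v≤1             = archimedean 1ℚ (ℚ.positive⁻¹ 1ℚ)
      in K ℕ.⊔ (L ℕ.⊔ L′) , λ n N≤n →
        let L⊔L′≤n = ℕ.m⊔n≤o⇒n≤o K (L ℕ.⊔ L′) N≤n
        in ≡.subst (λ e → seq x n ℚ.≤ seq (√ x) n ℚ.* seq (√ x) n ℚ.+ e) δ[B+B+1]≡ε
          (upper-square {seq (√ x) n} {seq x n} {1ℤ ℚ./ suc n} {δ} (√-nonNeg x n) (1/-nonNeg n)
            (v≤δ n (ℕ.m⊔n≤o⇒m≤o L L′ L⊔L′≤n)) (√-approx-upper n (seq x n)) {B} (ℚ.<⇒≤ 0<B)
            (ℚ.≤-trans (p≤∣p∣ (seq (√ x) n)) (b n (ℕ.m⊔n≤o⇒m≤o K (L ℕ.⊔ L′) N≤n)))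
            (v≤1 n (ℕ.m⊔n≤o⇒n≤o L L′ L⊔L′≤n)))

  √-cong : NonNeg y → x ≈ℝ y → √ x ≈ℝ √ y
  √-cong {y} {x} 0≤y x≈y = √-unique {√ y} {x} (√-nonNeg y)
    (≈-trans {√ y *ℝ √ y} {y} {x} (√-square {y} 0≤y) (≈-sym {x} {y} x≈y))

  *-interchange : ∀ p q r s → (p ℚ.* q) ℚ.* (r ℚ.* s) ≡ (p ℚ.* r) ℚ.* (q ℚ.* s)
  *-interchange = solve-∀ ℚ-ring

  √-* : NonNeg x → NonNeg y → √ (x *ℝ y) ≈ℝ √ x *ℝ √ y
  √-* {x} {y} 0≤x 0≤y = √-unique {√ x *ℝ √ y} {x *ℝ y} (λ n → *-nonNeg (√-nonNeg x n) (√-nonNeg y n)) (begin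
    (√ x *ℝ √ y) *ℝ (√ x *ℝ √ y)   ≈⟨ ≗⇒≈ {(√ x *ℝ √ y) *ℝ (√ x *ℝ √ y)} {(√ x *ℝ √ x) *ℝ (√ y *ℝ √ y)}
                                        (λ n → *-interchange (seq (√ x) n) (seq (√ y) n) (seq (√ x) n) (seq (√ y) n)) ⟩
    (√ x *ℝ √ x) *ℝ (√ y *ℝ √ y)   ≈⟨ *-cong {√ x *ℝ √ x} {x} {√ y *ℝ √ y} {y} (√-square {x} 0≤x) (√-square {y} 0≤y) ⟩
    x *ℝ y                         ∎)
    where open import Relation.Binary.Reasoning.Setoid (Preorder.Eq.setoid ≤-preorder)

  ∣∣ℂ²-nonNeg : ∀ z → NonNeg (re z *ℝ re z +ℝ im z *ℝ im z)
  ∣∣ℂ²-nonNeg z n = ℚ.+-mono-≤ (square-nonNeg (seq (re z) n)) (square-nonNeg (seq (im z) n))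

  ∣∣ℂ-cong : ∀ {z w} → z ≈ℂ w → ∣ z ∣ℂ ≈ℝ ∣ w ∣ℂ
  ∣∣ℂ-cong {z} {w} (re≈ , im≈) = √-cong {re w *ℝ re w +ℝ im w *ℝ im w} {re z *ℝ re z +ℝ im z *ℝ im z} (∣∣ℂ²-nonNeg w)
    (+-cong {re z *ℝ re z} {re w *ℝ re w} {im z *ℝ im z} {im w *ℝ im w}
      (*-cong {re z} {re w} {re z} {re w} re≈ re≈) (*-cong {im z} {im w} {im z} {im w} im≈ im≈))

  norm-scale : ∀ r a b → (r ℚ.* r) ℚ.* (a ℚ.* a ℚ.+ b ℚ.* b) ≡ (r ℚ.* a) ℚ.* (r ℚ.* a) ℚ.+ (r ℚ.* b) ℚ.* (r ℚ.* b)
  norm-scale = solve-∀ ℚ-ring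

  ∣•∣ℂ : ∀ r z → NonNeg r → ∣ r •ℂ z ∣ℂ ≈ℝ r *ℝ ∣ z ∣ℂ
  ∣•∣ℂ r z 0≤r = √-unique {r *ℝ m} {sq (r •ℂ z)} (λ n → *-nonNeg (0≤r n) (√-nonNeg (sq z) n)) (begin
    (r *ℝ m) *ℝ (r *ℝ m)     ≈⟨ ≗⇒≈ {(r *ℝ m) *ℝ (r *ℝ m)} {(r *ℝ r) *ℝ (m *ℝ m)}
                                 (λ n → *-interchange (seq r n) (seq m n) (seq r n) (seq m n)) ⟩
    (r *ℝ r) *ℝ (m *ℝ m)     ≈⟨ *-congˡ {m *ℝ m} {sq z} (r *ℝ r) (√-square {sq z} (∣∣ℂ²-nonNeg z)) ⟩
    (r *ℝ r) *ℝ sq z         ≈⟨ ≗⇒≈ {(r *ℝ r) *ℝ sq z} {sq (r •ℂ z)}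
                                 (λ n → norm-scale (seq r n) (seq (re z) n) (seq (im z) n)) ⟩
    sq (r •ℂ z)              ∎)
    where
    open import Relation.Binary.Reasoning.Setoid (Preorder.Eq.setoid ≤-preorder)
    sq : ℂ → ℝ
    sq w = re w *ℝ re w +ℝ im w *ℝ im w
    m = ∣ z ∣ℂ

  +ℂ-commutativeMonoid : CommutativeMonoid 0ℓ 0ℓ
  +ℂ-commutativeMonoid = record
    { Carrier = ℂ
    ; _≈_     = _≈ℂ_
    ; _∙_     = _+ℂ_
    ; ε       = 0ℂ
    ; isCommutativeMonoid = record
      { isMonoid = record
        { isSemigroup = record
          { isMagma = record
            { isEquivalence = record
              { refl  = λ {z} → ≈-refl {re z} , ≈-refl {im z}
              ; sym   = λ {z} {w} (h , k) → ≈-sym {re z} {re w} h , ≈-sym {im z} {im w} k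
              ; trans = λ {z} {w} {t} (h , k) (h′ , k′) →
                  ≈-trans {re z} {re w} {re t} h h′ , ≈-trans {im z} {im w} {im t} k k′
              }
            ; ∙-cong = λ {z} {w} {s} {t} (h , k) (h′ , k′) →
                +-cong {re z} {re w} {re s} {re t} h h′ , +-cong {im z} {im w} {im s} {im t} k k′
            }
          ; assoc = λ z w t → both ((z +ℂ w) +ℂ t) (z +ℂ (w +ℂ t))
              (λ n → ℚ.+-assoc (seq (re z) n) (seq (re w) n) (seq (re t) n))
              (λ n → ℚ.+-assoc (seq (im z) n) (seq (im w) n) (seq (im t) n))
          }
        ; identity =
            (λ z → both (0ℂ +ℂ z) z (λ n → ℚ.+-identityˡ (seq (re z) n)) (λ n → ℚ.+-identityˡ (seq (im z) n))) ,
            (λ z → both (z +ℂ 0ℂ) z (λ n → ℚ.+-identityʳ (seq (re z) n)) (λ n → ℚ.+-identityʳ (seq (im z) n)))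
        }
      ; comm = λ z w → both (z +ℂ w) (w +ℂ z)
          (λ n → ℚ.+-comm (seq (re z) n) (seq (re w) n)) (λ n → ℚ.+-comm (seq (im z) n) (seq (im w) n))
      }
    }
    where
    both : ∀ z w → (∀ n → seq (re z) n ≡ seq (re w) n) → (∀ n → seq (im z) n ≡ seq (im w) n) → z ≈ℂ w
    both z w h k = ≗⇒≈ {re z} {re w} h , ≗⇒≈ {im z} {im w} k

  suc-* : ∀ m p → p ℚ.+ (ℤ.+ m ℚ./ 1) ℚ.* p ≡ (ℤ.+ suc m ℚ./ 1) ℚ.* p
  suc-* m p = begin
    p ℚ.+ (ℤ.+ m ℚ./ 1) ℚ.* p             ≡⟨ ≡.cong (ℚ._+ (ℤ.+ m ℚ./ 1) ℚ.* p) (ℚ.*-identityˡ p) ⟨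
    1ℚ ℚ.* p ℚ.+ (ℤ.+ m ℚ./ 1) ℚ.* p      ≡⟨ ℚ.*-distribʳ-+ p 1ℚ (ℤ.+ m ℚ./ 1) ⟨
    (1ℚ ℚ.+ (ℤ.+ m ℚ./ 1)) ℚ.* p          ≡⟨ ≡.cong (ℚ._* p) (suc/1 m) ⟨
    (ℤ.+ suc m ℚ./ 1) ℚ.* p               ∎
    where open ≡.≡-Reasoning

  ×≈•ℂ : ∀ m z → multiple (CommutativeMonoid.rawMonoid +ℂ-commutativeMonoid) m z ≈ℂ fromℕ m •ℂ z
  ×≈•ℂ m z = ≗⇒≈ {re (m × z)} {re (fromℕ m •ℂ z)} (λ n → pointwise-re m n) ,
             ≗⇒≈ {im (m × z)} {im (fromℕ m •ℂ z)} (λ n → pointwise-im m n)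
    where
    _×_ = multiple (CommutativeMonoid.rawMonoid +ℂ-commutativeMonoid)
    pointwise-re : ∀ m n → seq (re (m × z)) n ≡ (ℤ.+ m ℚ./ 1) ℚ.* seq (re z) n
    pointwise-re zero    n = ≡.sym (ℚ.*-zeroˡ (seq (re z) n))
    pointwise-re (suc m) n = ≡.trans (≡.cong (seq (re z) n ℚ.+_) (pointwise-re m n)) (suc-* m (seq (re z) n))
    pointwise-im : ∀ m n → seq (im (m × z)) n ≡ (ℤ.+ m ℚ./ 1) ℚ.* seq (im z) n
    pointwise-im zero    n = ≡.sym (ℚ.*-zeroˡ (seq (im z) n))
    pointwise-im (suc m) n = ≡.trans (≡.cong (seq (im z) n ℚ.+_) (pointwise-im m n)) (suc-* m (seq (im z) n))

-- Salem numbers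

open RealProperties

∑-1≡length : (xs : List A) → Sum.∑ ℕ.+-0-commutativeMonoid (λ _ → 1) xs ≡ List.length xs
∑-1≡length []       = ≡.refl
∑-1≡length (x ∷ xs) = ≡.cong suc (∑-1≡length xs)

×≡* : ∀ m n → multiple ℕ.+-0-rawMonoid m n ≡ m ℕ.* n
×≡* zero    n = ≡.refl
×≡* (suc m) n = ≡.cong (n ℕ.+_) (×≡* m n)

fromℕ-nonNeg : ∀ n → NonNeg (fromℕ n)
fromℕ-nonNeg n _ = ℚ.nonNegative⁻¹ (ℤ.+ n ℚ./ 1) {{ℚ.normalize-nonNeg n 1}}

√-fromℕ-* : ∀ m n → √ (fromℕ (m ℕ.* n)) ≈ℝ √ (fromℕ m) *ℝ √ (fromℕ n)
√-fromℕ-* m n = ≈-trans {√ (fromℕ (m ℕ.* n))} {√ (fromℕ m *ℝ fromℕ n)} {√ (fromℕ m) *ℝ √ (fromℕ n)}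
  (√-cong {fromℕ m *ℝ fromℕ n} {fromℕ (m ℕ.* n)}
    (λ k → *-nonNeg (fromℕ-nonNeg m k) (fromℕ-nonNeg n k))
    (≗⇒≈ {fromℕ (m ℕ.* n)} {fromℕ m *ℝ fromℕ n} (λ _ → */1 m n)))
  (√-* {fromℕ m} {fromℕ n} (fromℕ-nonNeg m) (fromℕ-nonNeg n))

Invertible : ℝ → Set
Invertible x = ∃ λ i → 0ℚ ℚ.≤ i Product.× ∀ n → seq x n ℚ.* i ≡ 1ℚ

abstract
  fromℚ-invertible : ∀ {p} → 0ℚ ℚ.< p → Invertible (fromℚ p)
  fromℚ-invertible {p} 0<p = ℚ.1/ p , ℚ.<⇒≤ (ℚ.positive⁻¹ (ℚ.1/ p) {{ℚ.1/pos⇒pos p}}) , λ _ → ℚ.*-inverseʳ p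
    where instance
      p>0 : ℚ.Positive p
      p>0 = ℚ.positive 0<p
      p≢0 : ℚ.NonZero p
      p≢0 = ℚ.pos⇒nonZero p

private
  rearrangeˡ : ∀ q m w j i s → (q ℚ.* (m ℚ.* w)) ℚ.* (j ℚ.* i ℚ.* s) ≡ (q ℚ.* i) ℚ.* (m ℚ.* j) ℚ.* (s ℚ.* w)
  rearrangeˡ = solve-∀ ℚ-ring

  rearrangeʳ : ∀ c q r t j i s → (c ℚ.* q ℚ.* (r ℚ.* t)) ℚ.* (j ℚ.* i ℚ.* s) ≡ (q ℚ.* i) ℚ.* (c ℚ.* r ℚ.* j ℚ.* s ℚ.* t)
  rearrangeʳ = solve-∀ ℚ-ring

  cancelˡ : ∀ q m w {j i} s → q ℚ.* i ≡ 1ℚ → m ℚ.* j ≡ 1ℚ → (q ℚ.* (m ℚ.* w)) ℚ.* (j ℚ.* i ℚ.* s) ≡ s ℚ.* w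
  cancelˡ q m w {j} {i} s qi≡1 mj≡1 = begin
    (q ℚ.* (m ℚ.* w)) ℚ.* (j ℚ.* i ℚ.* s)       ≡⟨ rearrangeˡ q m w j i s ⟩
    (q ℚ.* i) ℚ.* (m ℚ.* j) ℚ.* (s ℚ.* w)       ≡⟨ ≡.cong₂ (λ x y → x ℚ.* y ℚ.* (s ℚ.* w)) qi≡1 mj≡1 ⟩
    1ℚ ℚ.* (s ℚ.* w)                            ≡⟨ ℚ.*-identityˡ (s ℚ.* w) ⟩
    s ℚ.* w                                     ∎
    where open ≡.≡-Reasoning

  cancelʳ : ∀ c q r t j {i} s → q ℚ.* i ≡ 1ℚ → (c ℚ.* q ℚ.* (r ℚ.* t)) ℚ.* (j ℚ.* i ℚ.* s) ≡ c ℚ.* r ℚ.* j ℚ.* s ℚ.* t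
  cancelʳ c q r t j {i} s qi≡1 = begin
    (c ℚ.* q ℚ.* (r ℚ.* t)) ℚ.* (j ℚ.* i ℚ.* s)       ≡⟨ rearrangeʳ c q r t j i s ⟩
    (q ℚ.* i) ℚ.* (c ℚ.* r ℚ.* j ℚ.* s ℚ.* t)         ≡⟨ ≡.cong (ℚ._* (c ℚ.* r ℚ.* j ℚ.* s ℚ.* t)) qi≡1 ⟩
    1ℚ ℚ.* (c ℚ.* r ℚ.* j ℚ.* s ℚ.* t)                ≡⟨ ℚ.*-identityˡ _ ⟩
    c ℚ.* r ℚ.* j ℚ.* s ℚ.* t                         ∎
    where open ≡.≡-Reasoning

rescale-≤ : ∀ {q m s w w′ c r t v} → Invertible q → ((j , _) : Invertible m) → NonNeg s →
            w′ ≈ℝ m *ℝ w → v ≈ℝ r *ℝ t →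
            q *ℝ w′ ≤ℝ c *ℝ q *ℝ v → s *ℝ w ≤ℝ c *ℝ r *ℝ fromℚ j *ℝ s *ℝ t
rescale-≤ {q} {m} {s} {w} {w′} {c} {r} {t} {v} (i , 0≤i , qi≡1) (j , 0≤j , mj≡1) 0≤s w′≈ v≈ h = begin
  s *ℝ w                           ≈⟨ ≗⇒≈ {q *ℝ (m *ℝ w) *ℝ κ} {s *ℝ w}
                                        (λ n → cancelˡ (seq q n) (seq m n) (seq w n) (seq s n) (qi≡1 n) (mj≡1 n)) ⟨
  q *ℝ (m *ℝ w) *ℝ κ               ≈⟨ *-congʳ {q *ℝ w′} {q *ℝ (m *ℝ w)} κ (*-congˡ {w′} {m *ℝ w} q w′≈) ⟨
  q *ℝ w′ *ℝ κ                     ≲⟨ *-monoˡ-≤ {q *ℝ w′} {c *ℝ q *ℝ v} κ (λ n → *-nonNeg (*-nonNeg 0≤j 0≤i) (0≤s n)) h ⟩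
  c *ℝ q *ℝ v *ℝ κ                 ≈⟨ *-congʳ {c *ℝ q *ℝ v} {c *ℝ q *ℝ (r *ℝ t)} κ (*-congˡ {v} {r *ℝ t} (c *ℝ q) v≈) ⟩
  c *ℝ q *ℝ (r *ℝ t) *ℝ κ          ≈⟨ ≗⇒≈ {c *ℝ q *ℝ (r *ℝ t) *ℝ κ} {c *ℝ r *ℝ fromℚ j *ℝ s *ℝ t}
                                        (λ n → cancelʳ (seq c n) (seq q n) (seq r n) (seq t n) j (seq s n) (qi≡1 n)) ⟩
  c *ℝ r *ℝ fromℚ j *ℝ s *ℝ t      ∎
  where
  open ≲-Reasoning ≤-preorder
  κ = fromℚ j *ℝ fromℚ i *ℝ s

private
  regroup : ∀ C r j → C ℚ.* r ℚ.* j ℚ.* r ≡ (C ℚ.* j) ℚ.* (r ℚ.* r)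
  regroup = solve-∀ ℚ-ring

cancel-square : ∀ {c r m} → ((j , _) : Invertible m) → r *ℝ r ≈ℝ m → c *ℝ r *ℝ fromℚ j *ℝ r ≈ℝ c
cancel-square {c} {r} {m} (j , _ , mj≡1) r²≈m = begin
  c *ℝ r *ℝ fromℚ j *ℝ r            ≈⟨ ≗⇒≈ {c *ℝ r *ℝ fromℚ j *ℝ r} {(c *ℝ fromℚ j) *ℝ (r *ℝ r)} (λ n → regroup (seq c n) (seq r n) j) ⟩
  (c *ℝ fromℚ j) *ℝ (r *ℝ r)        ≈⟨ *-congˡ {r *ℝ r} {m} (c *ℝ fromℚ j) r²≈m ⟩
  (c *ℝ fromℚ j) *ℝ m               ≈⟨ ≗⇒≈ {(c *ℝ fromℚ j) *ℝ m} {c} (λ n → cancel (seq c n) (seq m n) (mj≡1 n)) ⟩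
  c                                 ∎
  where
  open ≈-Reasoning (Preorder.Eq.setoid ≤-preorder)
  cancel : ∀ c m → m ℚ.* j ≡ 1ℚ → c ℚ.* j ℚ.* m ≡ c
  cancel c m mj≡1 = ≡.trans (ℚ.*-assoc c j m)
    (≡.trans (≡.cong (c ℚ.*_) (≡.trans (ℚ.*-comm j m) mj≡1)) (ℚ.*-identityʳ c))

module _ (R : FiniteRing a ℓ) where
  open FiniteRing R

  ∣J∣-nonZero : ℕ.NonZero (∣J∣ R)
  ∣J∣-nonZero = Fin.nonZeroIndex (index (∈-filter⁺ setoid (J? R) resp (enumerates 0#) 0∈))
    where open IsIdeal (isIdeal-J R)

  module _ (d : ℕ) where
    private instance
      ∣R∣^d≢0 : ℕ.NonZero (card ℕ.^ d)
      ∣R∣^d≢0 = ℕ.m^n≢0 card d {{card-nonZero}}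

    1/∣R∣^-nonNeg : NonNeg (1/∣R∣^ R d)
    1/∣R∣^-nonNeg _ = ℚ.nonNegative⁻¹ (1ℤ ℚ./ (card ℕ.^ d)) {{ℚ.normalize-nonNeg 1 (card ℕ.^ d)}}

    1/∣R∣^-invertible : Invertible (1/∣R∣^ R d)
    1/∣R∣^-invertible = fromℚ-invertible {1ℤ ℚ./ (card ℕ.^ d)}
      (ℚ.positive⁻¹ (1ℤ ℚ./ (card ℕ.^ d)) {{ℚ.normalize-pos 1 (card ℕ.^ d)}})

  module _ {n} (f : ℤ⟨X⟩ n) (c : ℤ) where

    sumV : Character R (suc n) → ℂ
    sumV ψ = sumℂ (List.map (Character.⟦_⟧ ψ) (members R {T = V R f c} (V? R f c)))

    ∣V∣ : ℕ
    ∣V∣ = ∣T∣ R {T = V R f c} (V? R f c)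

    SumBound : ℝ → Set (a ⊔ ℓ)
    SumBound C = ∀ ψ → ¬ IsTrivial R ψ → 1/∣R∣^ R (suc n) *ℝ ∣ sumV ψ ∣ℂ ≤ℝ C *ℝ 1/∣R∣^ R (suc n) *ℝ √ (fromℕ ∣V∣)

    private
      sumV-def : ∀ ψ → sumℂ (List.map (Character.⟦_⟧ ψ) (members R {T = V R f c} (V? R f c))) ≡ sumV ψ
      sumV-def ψ = ≡.refl

      ∣V∣-def : ∣T∣ R {T = V R f c} (V? R f c) ≡ ∣V∣
      ∣V∣-def = ≡.refl

      fourier-def : ∀ ψ → fourier R {T = V R f c} (V? R f c) ψ ≡
                    1/∣R∣^ R (suc n) •ℂ sumℂ (List.map (Character.⟦_⟧ ψ) (members R {T = V R f c} (V? R f c)))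
      fourier-def ψ = ≡.refl

      fourier≡ : ∀ ψ → fourier R {T = V R f c} (V? R f c) ψ ≡ 1/∣R∣^ R (suc n) •ℂ sumV ψ
      fourier≡ ψ = ≡.subst (λ z → fourier R {T = V R f c} (V? R f c) ψ ≡ 1/∣R∣^ R (suc n) •ℂ z)
        {sumℂ (List.map (Character.⟦_⟧ ψ) (members R {T = V R f c} (V? R f c)))} {sumV ψ} (sumV-def ψ) (fourier-def ψ)

      ∣fourier∣ : ∀ ψ → ∣ fourier R {T = V R f c} (V? R f c) ψ ∣ℂ ≈ℝ 1/∣R∣^ R (suc n) *ℝ ∣ sumV ψ ∣ℂ
      ∣fourier∣ ψ = ≡.subst (λ z → ∣ z ∣ℂ ≈ℝ 1/∣R∣^ R (suc n) *ℝ ∣ sumV ψ ∣ℂ)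
        {1/∣R∣^ R (suc n) •ℂ sumV ψ} {fourier R {T = V R f c} (V? R f c) ψ}
        (≡.sym {x = fourier R {T = V R f c} (V? R f c) ψ} {1/∣R∣^ R (suc n) •ℂ sumV ψ} (fourier≡ ψ))
        (∣•∣ℂ (1/∣R∣^ R (suc n)) (sumV ψ) (1/∣R∣^-nonNeg (suc n)))

    isSalem⇒sumBound : ∀ {C} → IsSalem R {T = V R f c} (V? R f c) C → SumBound C
    isSalem⇒sumBound {C} salem ψ ψ≉1 = ≤-trans
      {1/∣R∣^ R (suc n) *ℝ ∣ sumV ψ ∣ℂ} {∣ fourier R {T = V R f c} (V? R f c) ψ ∣ℂ} {C *ℝ 1/∣R∣^ R (suc n) *ℝ √ (fromℕ ∣V∣)}
      (≈⇒≥ {∣ fourier R {T = V R f c} (V? R f c) ψ ∣ℂ} {1/∣R∣^ R (suc n) *ℝ ∣ sumV ψ ∣ℂ} (∣fourier∣ ψ))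
      (≡.subst (λ m → ∣ fourier R {T = V R f c} (V? R f c) ψ ∣ℂ ≤ℝ C *ℝ 1/∣R∣^ R (suc n) *ℝ √ (fromℕ m)) ∣V∣-def (salem ψ ψ≉1))

    sumBound⇒isSalem : ∀ {C} → SumBound C → IsSalem R {T = V R f c} (V? R f c) C
    sumBound⇒isSalem {C} bound ψ ψ≉1 =
      ≡.subst (λ m → ∣ fourier R {T = V R f c} (V? R f c) ψ ∣ℂ ≤ℝ C *ℝ 1/∣R∣^ R (suc n) *ℝ √ (fromℕ m)) (≡.sym ∣V∣-def)
        (≤-trans {∣ fourier R {T = V R f c} (V? R f c) ψ ∣ℂ} {1/∣R∣^ R (suc n) *ℝ ∣ sumV ψ ∣ℂ} {C *ℝ 1/∣R∣^ R (suc n) *ℝ √ (fromℕ ∣V∣)}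
          (≈⇒≤ {∣ fourier R {T = V R f c} (V? R f c) ψ ∣ℂ} {1/∣R∣^ R (suc n) *ℝ ∣ sumV ψ ∣ℂ} (∣fourier∣ ψ))
          (bound ψ ψ≉1))

    isSalemNumber⇒sumBound : ∀ {C} → IsSalemNumber R f c C → SumBound C
    isSalemNumber⇒sumBound {C} (salem , _) = isSalem⇒sumBound {C} salem

    isSalemNumber⇒≤ : ∀ {C C′} → IsSalemNumber R f c C → SumBound C′ → C ≤ℝ C′
    isSalemNumber⇒≤ {_} {C′} (_ , minimal) bound = minimal C′ (sumBound⇒isSalem {C′} bound)

module _ {n} (R : FiniteRing a ℓ) (f : ℤ⟨X⟩ n) (c : ℤ) where

  abstract
    ∣J∣^n-invertible : Invertible (fromℕ (∣J∣ R ℕ.^ n))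
    ∣J∣^n-invertible = fromℚ-invertible {ℤ.+ (∣J∣ R ℕ.^ n) ℚ./ 1} (ℚ.positive⁻¹ (ℤ.+ (∣J∣ R ℕ.^ n) ℚ./ 1)
      {{ℚ.normalize-pos (∣J∣ R ℕ.^ n) 1 {{_}} {{ℕ.m^n≢0 (∣J∣ R) n {{∣J∣-nonZero R}}}}}})

  ∣V∣-semisimplePart : ∣V∣ R f c ≡ (∣J∣ R ℕ.^ n) ℕ.* ∣V∣ (semisimplePart R) f c
  ∣V∣-semisimplePart = begin
    ∣V∣ R f c                                                      ≡⟨ ∑-1≡length (members R (V? R f c)) ⟨
    ∑ (λ _ → 1) (members R (V? R f c))                             ≡⟨ ∑-V R ℕ.+-0-commutativeMonoid f c (λ _ → 1) (λ _ → ≡.refl) ⟩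
    N × ∑ (λ _ → 1) (members (semisimplePart R) (V? (semisimplePart R) f c))
                                                                   ≡⟨ ≡.cong (N ×_) (∑-1≡length (members (semisimplePart R) (V? (semisimplePart R) f c))) ⟩
    N × ∣V∣ (semisimplePart R) f c                                 ≡⟨ ×≡* N (∣V∣ (semisimplePart R) f c) ⟩
    N ℕ.* ∣V∣ (semisimplePart R) f c                               ∎
    where
    open Sum ℕ.+-0-commutativeMonoid using (∑; _×_)
    open ≡.≡-Reasoning
    N = ∣J∣ R ℕ.^ n

  √∣V∣-semisimplePart : √ (fromℕ (∣V∣ R f c)) ≈ℝ √ (fromℕ (∣J∣ R ℕ.^ n)) *ℝ √ (fromℕ (∣V∣ (semisimplePart R) f c))
  √∣V∣-semisimplePart = ≡.subst
    (λ k → √ (fromℕ k) ≈ℝ √ (fromℕ (∣J∣ R ℕ.^ n)) *ℝ √ (fromℕ (∣V∣ (semisimplePart R) f c)))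
    (≡.sym ∣V∣-semisimplePart) (√-fromℕ-* (∣J∣ R ℕ.^ n) (∣V∣ (semisimplePart R) f c))

  sumV-lift : ∀ ψ → sumV R f c (lift R ψ) ≈ℂ fromℕ (∣J∣ R ℕ.^ n) •ℂ sumV (semisimplePart R) f c ψ
  sumV-lift ψ = CommutativeMonoid.trans +ℂ-commutativeMonoid
    {sumV R f c (lift R ψ)}
    {multiple (CommutativeMonoid.rawMonoid +ℂ-commutativeMonoid) (∣J∣ R ℕ.^ n) (sumV (semisimplePart R) f c ψ)}
    {fromℕ (∣J∣ R ℕ.^ n) •ℂ sumV (semisimplePart R) f c ψ}
    (∑-V R +ℂ-commutativeMonoid f c ⟦_⟧ ⟦⟧-cong) (×≈•ℂ (∣J∣ R ℕ.^ n) (sumV (semisimplePart R) f c ψ))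
    where
    open Character ψ
    open MonoidMorphisms.IsMonoidHomomorphism isHomomorphism using (⟦⟧-cong)

  ∣sumV-lift∣ : ∀ ψ → ∣ sumV R f c (lift R ψ) ∣ℂ ≈ℝ fromℕ (∣J∣ R ℕ.^ n) *ℝ ∣ sumV (semisimplePart R) f c ψ ∣ℂ
  ∣sumV-lift∣ ψ = ≈-trans
    {∣ sumV R f c (lift R ψ) ∣ℂ} {∣ fromℕ (∣J∣ R ℕ.^ n) •ℂ sumV (semisimplePart R) f c ψ ∣ℂ}
    {fromℕ (∣J∣ R ℕ.^ n) *ℝ ∣ sumV (semisimplePart R) f c ψ ∣ℂ}
    (∣∣ℂ-cong {sumV R f c (lift R ψ)} {fromℕ (∣J∣ R ℕ.^ n) •ℂ sumV (semisimplePart R) f c ψ} (sumV-lift ψ))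
    (∣•∣ℂ (fromℕ (∣J∣ R ℕ.^ n)) (sumV (semisimplePart R) f c ψ) (fromℕ-nonNeg (∣J∣ R ℕ.^ n)))

  sumBound-semisimplePart : ∀ {C} → SumBound R f c C →
    SumBound (semisimplePart R) f c (C *ℝ √ (fromℕ (∣J∣ R ℕ.^ n)) *ℝ fromℚ (proj₁ ∣J∣^n-invertible))
  sumBound-semisimplePart {C} bound ψ ψ≉1 = rescale-≤
    {1/∣R∣^ R (suc n)} {fromℕ (∣J∣ R ℕ.^ n)} {1/∣R∣^ (semisimplePart R) (suc n)}
    {∣ sumV (semisimplePart R) f c ψ ∣ℂ} {∣ sumV R f c (lift R ψ) ∣ℂ}
    {C} {√ (fromℕ (∣J∣ R ℕ.^ n))} {√ (fromℕ (∣V∣ (semisimplePart R) f c))} {√ (fromℕ (∣V∣ R f c))}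
    (1/∣R∣^-invertible R (suc n)) ∣J∣^n-invertible (1/∣R∣^-nonNeg (semisimplePart R) (suc n))
    (∣sumV-lift∣ ψ) √∣V∣-semisimplePart (bound (lift R ψ) ψ≉1)

  salemNumber-≤ : ∀ {C-R C-S} → IsSalemNumber R f c C-R → IsSalemNumber (semisimplePart R) f c C-S →
                  C-S *ℝ √ (fromℕ (∣J∣ R ℕ.^ n)) ≤ℝ C-R
  salemNumber-≤ {C} {C-S} C-salem C-S-salem = ≤-trans
    {C-S *ℝ √ (fromℕ (∣J∣ R ℕ.^ n))}
    {C *ℝ √ (fromℕ (∣J∣ R ℕ.^ n)) *ℝ fromℚ (proj₁ ∣J∣^n-invertible) *ℝ √ (fromℕ (∣J∣ R ℕ.^ n))}
    {C}
    (*-monoˡ-≤ {C-S} {C *ℝ √ (fromℕ (∣J∣ R ℕ.^ n)) *ℝ fromℚ (proj₁ ∣J∣^n-invertible)}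
      (√ (fromℕ (∣J∣ R ℕ.^ n))) (√-nonNeg (fromℕ (∣J∣ R ℕ.^ n)))
      (isSalemNumber⇒≤ (semisimplePart R) f c {C-S} {C *ℝ √ (fromℕ (∣J∣ R ℕ.^ n)) *ℝ fromℚ (proj₁ ∣J∣^n-invertible)} C-S-salem
        (sumBound-semisimplePart {C} (isSalemNumber⇒sumBound R f c {C} C-salem))))
    (≈⇒≤ {C *ℝ √ (fromℕ (∣J∣ R ℕ.^ n)) *ℝ fromℚ (proj₁ ∣J∣^n-invertible) *ℝ √ (fromℕ (∣J∣ R ℕ.^ n))} {C}
      (cancel-square {C} {√ (fromℕ (∣J∣ R ℕ.^ n))} {fromℕ (∣J∣ R ℕ.^ n)} ∣J∣^n-invertible
        (√-square {fromℕ (∣J∣ R ℕ.^ n)} (fromℕ-nonNeg (∣J∣ R ℕ.^ n)))))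

lemma2p26 : ∀ {a ℓ} (d-1 : ℕ) → 2 ≤ suc d-1 →
    (f : ℤ⟨X⟩ d-1) → constantTerm f ≡ 0ℤ → (c : ℤ) →
    (R : FiniteRing a ℓ) (C-R C-S : ℝ) →
    IsSalemNumber R f c C-R →
    IsSalemNumber (semisimplePart R) f c C-S →
    C-R ≥ℝ C-S *ℝ √ (fromℕ (∣J∣ R ^ d-1))
lemma2p26 d-1 _ f _ c R C-R C-S isSalemNumber-R isSalemNumber-S =
  salemNumber-≤ R f c {C-R} {C-S} isSalemNumber-R isSalemNumber-S
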